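{- Let $r\ge 3$ be a fixed integer. The number of copies of $K_r$ (subgraphs isomorphic to the complete graph on $r$ vertices) in an input simple undirected graph on $n$ vertices can be computed in $O(n^{r-1} + n^{\omega_{r-1}})$ time.
   Context: For $k$ matrices $A_1,\dots,A_k$ of size $n\times n$, their $k$-dimensional matrix product is the $k$-dimensional array $D$ with $D[i_1,\dots,i_k] = \sum_{\ell=1}^n A_1[i_1,\ell]A_2[i_2,\ell]\cdots A_k[i_k,\ell]$. $\omega_k$ denotes the exponent of fast $k$-dimensional (arithmetic) matrix product of $k$ $n\times n$ matrices. -}

module Defs where

open import Data.Bool using (Bool; true; false; not; if_then_else_)
open import Data.Fin as Fin using (Fin; toℕ; combine; funToFin)
open import Data.Fin.Subset using (Subset; _∈_)
open import Data.Integer as ℤ using (ℤ; +_; -[1+_]; 0ℤ; 1ℤ; ∣_∣)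
import Data.Integer.Properties as ℤₚ
open import Data.List using (List; length)
import Data.List.Membership.Propositional as List
open import Data.List.Relation.Unary.Unique.Propositional using (Unique)
open import Data.Nat as ℕ using (ℕ; suc; _+_; _*_; _∸_; _^_; _≤_)
open import Data.Product using (Σ; ∃; _×_; _,_; proj₁)
open import Data.Rational as ℚ using (ℚ; ↥_; ↧ₙ_)
import Data.Rational.Properties as ℚₚ
open import Data.Vec using (Vec; lookup)
open import Function.Bundles using (_⇔_)
open import Function.Definitions using (Injective)
open import Relation.Binary.PropositionalEquality using (_≡_; refl; sym)
open import Relation.Nullary.Decidable using (yes; no; ⌊_⌋)
open import Relation.Nullary.Negation using (¬_; contradiction)

import Algebra.Properties.CommutativeMonoid.Sum as Sum
open Sum ℤₚ.+-0-commutativeMonoid using (sum)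
open Sum ℤₚ.*-1-commutativeMonoid using () renaming (sum to product)

------------------------------------------------------------------------
-- Graphs and copies of K_r

record Graph (n : ℕ) : Set where
  field
    adj         : Fin n → Fin n → Bool
    symmetric   : ∀ u v → adj u v ≡ adj v u
    irreflexive : ∀ v → adj v v ≡ false

open Graph public

K : ∀ r → Graph r
K r = record
  { adj         = λ i j → not ⌊ i Fin.≟ j ⌋
  ; symmetric   = symm
  ; irreflexive = irr
  }
  where
  symm : ∀ i j → not ⌊ i Fin.≟ j ⌋ ≡ not ⌊ j Fin.≟ i ⌋
  symm i j with i Fin.≟ j | j Fin.≟ i
  ... | yes _ | yes _ = refl
  ... | no _  | no _  = refl
  ... | yes p | no ¬q = contradiction (sym p) ¬q
  ... | no ¬p | yes q = contradiction (sym q) ¬p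

  irr : ∀ i → not ⌊ i Fin.≟ i ⌋ ≡ false
  irr i with i Fin.≟ i
  ... | yes _ = refl
  ... | no ¬p = contradiction refl ¬p

-- A vertex set and an edge set, the latter as a 0/1 matrix. First-order
-- data, so that propositional equality is equality of subgraphs.
record VertexEdgeSet (n : ℕ) : Set where
  constructor ⟨_,_⟩
  field
    vertices : Subset n
    edges    : Vec (Vec Bool n) n

  edge : Fin n → Fin n → Bool
  edge u v = lookup (lookup edges u) v

open VertexEdgeSet public

record IsSubgraph {n} (G : Graph n) (H : VertexEdgeSet n) : Set where
  field
    edge-sym : ∀ u v → edge H u v ≡ edge H v u
    edge-end : ∀ u v → edge H u v ≡ true → u ∈ vertices H
    edge-adj : ∀ u v → edge H u v ≡ true → adj G u v ≡ true

record _≅_ {r n} (F : Graph r) (H : VertexEdgeSet n) : Set where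
  field
    to         : Fin r → Fin n
    injective  : Injective _≡_ _≡_ to
    image      : ∀ v → v ∈ vertices H ⇔ (∃ λ i → to i ≡ v)
    preserves  : ∀ i j → edge H (to i) (to j) ≡ adj F i j

IsCopyOf : ∀ {r n} → Graph r → Graph n → VertexEdgeSet n → Set
IsCopyOf F G H = IsSubgraph G H × F ≅ H

HasCardinality : {A : Set} → (A → Set) → ℕ → Set
HasCardinality {A} P N =
  Σ (List A) λ xs → Unique xs × (∀ x → x List.∈ xs ⇔ P x) × length xs ≡ N

------------------------------------------------------------------------
-- k-dimensional matrix product

Matrix : ℕ → Set
Matrix n = Fin n → Fin n → ℤ

dimProduct : ∀ {k n} → (Fin k → Matrix n) → (Fin k → Fin n) → ℤ
dimProduct A i = sum λ ℓ → product λ j → A j (i j) ℓ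

adjacencyMatrix : ∀ {n} → Graph n → Matrix n
adjacencyMatrix G u v = if adj G u v then 1ℤ else 0ℤ

------------------------------------------------------------------------
-- Word RAM: structured programs over integer registers and arrays. A
-- program mentions finitely many register and array names; array cells
-- are addressed indirectly.

Reg Arr : Set
Reg = ℕ
Arr = ℕ

data Operand : Set where
  reg : Reg → Operand
  lit : ℤ → Operand

data Op : Set where
  add sub mul div : Op

data Program : Set where
  skip            : Program
  _≔_⟨_⟩_         : Reg → Operand → Op → Operand → Program
  _≔_[_]          : Reg → Arr → Operand → Program
  _[_]≔_          : Arr → Operand → Operand → Program
  _⨾_             : Program → Program → Program
  IF_<_THEN_ELSE_ : Operand → Operand → Program → Program → Program
  WHILE_<_DO_     : Operand → Operand → Program → Program

record State : Set where
  constructor state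
  field
    regs   : Reg → ℤ
    arrays : Arr → ℕ → ℤ

open State public

⟦_⟧ : Operand → State → ℤ
⟦ reg x ⟧ s = regs s x
⟦ lit z ⟧ s = z

-- Division by zero yields zero.
apply : Op → ℤ → ℤ → ℤ
apply add x y          = x ℤ.+ y
apply sub x y          = x ℤ.- y
apply mul x y          = x ℤ.* y
apply div x (+ 0)      = 0ℤ
apply div x y@(+ suc _)  = x ℤ./ y
apply div x y@(-[1+ _ ]) = x ℤ./ y

setReg : Reg → ℤ → State → State
setReg x v s = state (λ y → if ⌊ x ℕ.≟ y ⌋ then v else regs s y) (arrays s)

setCell : Arr → ℕ → ℤ → State → State
setCell a i v s = state (regs s) λ b j →
  if ⌊ a ℕ.≟ b ⌋ then (if ⌊ i ℕ.≟ j ⌋ then v else arrays s b j) else arrays s b j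

-- W ⊢ c , s ⇓ s′ , t : started in s, the program c halts in s′ after t
-- steps, and every value it writes has absolute value at most W.
-- Overflow and negative addresses have no rule. Bounding W matters: with
-- unbounded integers at unit cost, packing whole rows into single numbers
-- would collapse the exponents of matrix product.
data _⊢_,_⇓_,_ (W : ℕ) : Program → State → State → ℕ → Set where
  skip : ∀ {s} → W ⊢ skip , s ⇓ s , 1

  assign : ∀ {s x e o f v} →
    apply o (⟦ e ⟧ s) (⟦ f ⟧ s) ≡ v → ∣ v ∣ ≤ W →
    W ⊢ (x ≔ e ⟨ o ⟩ f) , s ⇓ setReg x v s , 1

  load : ∀ {s x a e i v} →
    ⟦ e ⟧ s ≡ + i → arrays s a i ≡ v → ∣ v ∣ ≤ W →
    W ⊢ (x ≔ a [ e ]) , s ⇓ setReg x v s , 1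

  store : ∀ {s a e f i v} →
    ⟦ e ⟧ s ≡ + i → ⟦ f ⟧ s ≡ v → ∣ v ∣ ≤ W →
    W ⊢ (a [ e ]≔ f) , s ⇓ setCell a i v s , 1

  seq : ∀ {c d s s′ s″ t u} →
    W ⊢ c , s ⇓ s′ , t → W ⊢ d , s′ ⇓ s″ , u →
    W ⊢ (c ⨾ d) , s ⇓ s″ , (t + u)

  if-true : ∀ {e f c d s s′ t} →
    ⟦ e ⟧ s ℤ.< ⟦ f ⟧ s → W ⊢ c , s ⇓ s′ , t →
    W ⊢ (IF e < f THEN c ELSE d) , s ⇓ s′ , suc t

  if-false : ∀ {e f c d s s′ t} →
    ¬ (⟦ e ⟧ s ℤ.< ⟦ f ⟧ s) → W ⊢ d , s ⇓ s′ , t →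
    W ⊢ (IF e < f THEN c ELSE d) , s ⇓ s′ , suc t

  while-true : ∀ {e f c s s′ s″ t u} →
    ⟦ e ⟧ s ℤ.< ⟦ f ⟧ s → W ⊢ c , s ⇓ s′ , t →
    W ⊢ (WHILE e < f DO c) , s′ ⇓ s″ , u →
    W ⊢ (WHILE e < f DO c) , s ⇓ s″ , suc (t + u)

  while-false : ∀ {e f c s} →
    ¬ (⟦ e ⟧ s ℤ.< ⟦ f ⟧ s) →
    W ⊢ (WHILE e < f DO c) , s ⇓ s , 1

------------------------------------------------------------------------
-- Problems and running times

record Problem : Set₁ where
  field
    Instance : ℕ → Set
    Input    : ∀ {n} → Instance n → State → Set
    Output   : ∀ {n} → Instance n → State → Set

open Problem public

Solves : Problem → Program → (W T : ℕ → ℕ) → Set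
Solves Π P W T = ∀ n (x : Instance Π n) s → Input Π x s →
  ∃ λ s′ → ∃ λ t → (W n ⊢ P , s ⇓ s′ , t) × t ≤ T n × Output Π x s′

-- Words of O(log n) bits, i.e. values bounded by a polynomial in n.
_SolvableInTime_ : Problem → ((ℕ → ℕ) → Set) → Set
Π SolvableInTime 𝓞 = ∃ λ P → ∃ λ d → ∃ λ T →
  Solves Π P (λ n → (2 + n) ^ d) T × 𝓞 T

-- n in register 0, the given matrices row by row in arrays 0 , … , m - 1,
-- and zero everywhere else.
record Holds {m n} (A : Fin m → Matrix n) (s : State) : Set where
  field
    size       : regs s 0 ≡ + n
    other-regs : ∀ x → regs s (suc x) ≡ 0ℤ
    entries    : ∀ j u v → arrays s (toℕ j) (toℕ (combine u v)) ≡ A j u v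
    padding    : ∀ a i → n * n ≤ i → arrays s a i ≡ 0ℤ
    other-arrs : ∀ a i → m ≤ a → arrays s a i ≡ 0ℤ

-- The array D is returned in array k, in lexicographic order of indices.
productProblem : (k c : ℕ) → Problem
productProblem k c = record
  { Instance = λ n → Σ (Fin k → Matrix n) λ A →
                 ∀ j u v → ∣ A j u v ∣ ≤ (2 + n) ^ c
  ; Input    = λ x s → Holds (proj₁ x) s
  ; Output   = λ {n} x s → (i : Fin k → Fin n) →
                 arrays s k (toℕ (funToFin i)) ≡ dimProduct (proj₁ x) i
  }

copyCounting : ∀ {r} → Graph r → Problem
copyCounting F = record
  { Instance = Graph
  ; Input    = λ G s → Holds {1} (λ _ → adjacencyMatrix G) s
  ; Output   = λ G s → ∃ λ N → HasCardinality (IsCopyOf F G) N × regs s 0 ≡ + N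
  }

------------------------------------------------------------------------
-- Real exponents

-- An (extended) real number, given by the set of rationals strictly above it.
record UpperReal : Set₁ where
  field
    above  : ℚ → Set
    upward : ∀ {p q} → above p → p ℚ.< q → above q
    open′  : ∀ {q} → above q → ∃ λ p → above p × p ℚ.< q

_<ℚ_ : UpperReal → ℚ → Set
α <ℚ q = UpperReal.above α q

rational : ℚ → UpperReal
rational p = record
  { above  = p ℚ.<_
  ; upward = ℚₚ.<-trans
  ; open′  = λ p<q → let m , p<m , m<q = ℚₚ.<-dense p<q in m , p<m , m<q
  }

-- x ≤ C · n ^ q, with denominators cleared.
_≤_·_^ℚ_ : ℕ → ℕ → ℕ → ℚ → Set
x ≤ C · n ^ℚ q with ↥ q
... | + a      = x ^ ↧ₙ q ≤ C ^ ↧ₙ q * n ^ a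
... | -[1+ a ] = x ^ ↧ₙ q * n ^ suc a ≤ C ^ ↧ₙ q

-- x ≤ C · n ^ α, where n ^ α is the infimum of n ^ q over q > α.
_≤_·_^ℝ_ : ℕ → ℕ → ℕ → UpperReal → Set
x ≤ C · n ^ℝ α = ∀ q → α <ℚ q → x ≤ C · n ^ℚ q

O[n^_] : UpperReal → (ℕ → ℕ) → Set
O[n^ α ] T = ∃ λ C → ∃ λ n₀ → ∀ n → n₀ ≤ n → T n ≤ C · n ^ℝ α

-- T n ≤ C · (n ^ a + n ^ α), with the integral term moved to the left.
O[n^_+n^_] : ℕ → UpperReal → (ℕ → ℕ) → Set
O[n^ a +n^ α ] T =
  ∃ λ C → ∃ λ n₀ → ∀ n → n₀ ≤ n → (T n ∸ C * n ^ a) ≤ C · n ^ℝ α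

-- Integer matrices with entries polynomially bounded in n.
ProductInTime : ℕ → UpperReal → Set
ProductInTime k α = ∀ c → productProblem k c SolvableInTime O[n^ α ]

-- ω k is the infimum of the rational p for which the k-dimensional product
-- can be computed in time O(n ^ p).
ω : ℕ → UpperReal
ω k = record
  { above  = λ q → ∃ λ p → ProductInTime k (rational p) × p ℚ.< q
  ; upward = λ (p , P , p<q) q<q′ → p , P , ℚₚ.<-trans p<q q<q′
  ; open′  = λ (p , P , p<q) →
      let m , p<m , m<q = ℚₚ.<-dense p<q in m , (p , P , p<m) , m<q
  }

{-# OPTIONS --safe #-}
-- Orient every edge from its larger to its smaller endpoint and let B be the
-- resulting 0/1 matrix. The (r-1)-dimensional product D of r-1 copies of B
-- counts, for each tuple i, the vertices ℓ below all of i and adjacent to all of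
-- i. If i ranges over the increasing (r-1)-cliques only, every copy of K_r is
-- counted once, with ℓ its least vertex, so no division by r! is needed. The
-- indicator table of the increasing cliques is built one vertex at a time: a
-- tuple x, y, z₁, …, zₘ is an increasing clique iff y → x is an arc and
-- both x, z₁, …, zₘ and y, z₁, …, zₘ are increasing cliques. Each of the r-1 tables takes time
-- linear in its size, at most n ^ (r-1).
module Submission where

open import Defs renaming (_⨾_ to infixr 5 _⨾_)
open import Data.Bool using (Bool; true; false; not; _∧_; if_then_else_)
import Data.Bool.Properties as Bool
open import Data.Fin as Fin using (Fin; zero; suc; toℕ; fromℕ<; combine; funToFin; finToFun; punchIn; punchOut)
import Data.Fin.Properties as Fin
open import Data.Fin.Subset using (_∈_)
open import Data.Fin.Subset.Properties using (⊆-antisym)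
open import Data.Integer as ℤ using (ℤ; +_; -[1+_]; 0ℤ; 1ℤ; ∣_∣)
import Data.Integer.DivMod as ℤ
import Data.Integer.Properties as ℤ
open import Data.List using (List; []; _∷_; length; map; filter; allFin; cartesianProduct; tabulate; _++_)
import Data.List.Membership.Propositional as List
open import Data.List.Membership.Propositional.Properties using (∈-map⁺; ∈-map⁻; ∈-filter⁺; ∈-filter⁻; ∈-cartesianProduct⁺; ∈-allFin)
open import Data.List.Properties using (length-map; filter-++; length-++)
open import Data.List.Relation.Unary.All using (All; []; _∷_)
open import Data.List.Relation.Unary.All.Properties using (all-filter)
open import Data.List.Relation.Unary.AllPairs using ([]; _∷_)
open import Data.List.Relation.Unary.Unique.Propositional using (Unique)
open import Data.List.Relation.Unary.Unique.Propositional.Properties using (allFin⁺; cartesianProduct⁺; filter⁺)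
open import Data.Nat as ℕ using (ℕ; zero; suc; _+_; _*_; _∸_; _^_; _≤_; _<_; z≤n; s≤s)
import Data.Nat.DivMod as ℕ
open import Data.Nat.Divisibility using (divides-refl)
import Data.Nat.Properties as ℕ
open import Data.Product using (∃; _×_; _,_; proj₁; proj₂)
open import Data.Rational using (ℚ; ↥_; ↧ₙ_)
import Data.Rational.Properties as ℚ
open import Data.Sum using (_⊎_; inj₁; inj₂)
open import Data.Vec as Vec using (Vec; lookup)
import Data.Vec.Functional as Vector
import Data.Vec.Properties as Vec
open import Function using (_∘_; id; _⇔_; mk⇔; Equivalence)
open import Function.Definitions using (Injective)
open import Relation.Binary.Definitions using (tri<; tri≈; tri>)
open import Relation.Binary.PropositionalEquality using (_≡_; _≢_; _≗_; refl; sym; trans; cong; cong₂; subst; subst₂; module ≡-Reasoning)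
open import Relation.Nullary.Decidable using (Dec; yes; no; ⌊_⌋; isYes≗does)
open import Relation.Nullary.Negation using (¬_; contradiction)

import Algebra.Properties.CommutativeMonoid.Sum as Product
import Algebra.Properties.Semiring.Sum as Sum
open Sum ℕ.+-*-semiring using () renaming (sum to ∑; sum-cong-≗ to ∑-cong; *-distribˡ-sum to *-distribˡ-∑; sum-init-last to ∑-init-last)
open Sum ℤ.+-*-semiring using () renaming (sum to ∑ℤ; sum-cong-≗ to ∑ℤ-cong)
open Product ℤ.*-1-commutativeMonoid using () renaming (sum to ∏ℤ)

open Equivalence using (to; from)

-- The matrix product is available only as an arbitrary program. It expects every cell outside its
-- input to be zero, and afterwards nothing but its output array is known; this forces the
-- relocation, across which only n and the oriented matrix are tracked. Running times are measured
-- in multiples of `M`, instantiated to (n + 1) ^ (r - 1): unlike n ^ (r - 1), it bounds every lower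
-- power of n and is positive also for n = 0, so constants add up without case distinctions.
-- Extending a table by one vertex takes three lookups, so the loop body is the same for every r,
-- whereas testing all pairs of a tuple would require code that grows with r. The exponent ω is an
-- infimum which no algorithm need attain. Hence the result has two halves, one for an attained
-- exponent and one for every rational above it; a single reduction from exponent α to exponent β
-- gives both.

private
  variable
    m n : ℕ

-- Increasing enumerations of finite sets of vertices

Increasing : (Fin m → Fin n) → Set
Increasing f = ∀ {i j} → i Fin.< j → f i Fin.< f j

_≃_ : (f g : Fin m → Fin n) → Set
f ≃ g = ∀ v → (∃ λ i → f i ≡ v) ⇔ (∃ λ i → g i ≡ v)

argmin : (g : Fin (suc m) → Fin n) → ∃ λ i → ∀ j → g i Fin.≤ g j
argmin {zero} g = zero , λ { zero → ℕ.≤-refl }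
argmin {suc m} g with argmin (g ∘ suc)
... | i , i-min with g zero Fin.≤? g (suc i)
...   | yes 0≤i = zero , λ { zero → ℕ.≤-refl ; (suc j) → ℕ.≤-trans 0≤i (i-min j) }
...   | no  0≰i = suc i , λ { zero → ℕ.<⇒≤ (ℕ.≰⇒> 0≰i) ; (suc j) → i-min j }

-- Selection sort: the position of the least value is removed by `punchIn` and the rest is sorted.
-- Injectivity makes the order strict.
sort : (g : Fin m → Fin n) → Injective _≡_ _≡_ g → ∃ λ (f : Fin m → Fin n) → Increasing f × f ≃ g
sort {zero} g _ = g , (λ { {()} }) , λ _ → mk⇔ id id
sort {suc m} {n} g g-inj with argmin g
... | i₀ , i₀-min with sort (g ∘ punchIn i₀) (Fin.punchIn-injective i₀ _ _ ∘ g-inj)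
...   | f , f-inc , f≃ = f′ , inc , λ v → mk⇔ (⇒ v) (⇐ v)
  where
  f′ : Fin (suc m) → Fin n
  f′ = g i₀ Vector.∷ f

  inc : Increasing f′
  inc {zero} {suc j} _ with to (f≃ (f j)) (j , refl)
  ... | l , gl≡fj = subst (g i₀ Fin.<_) gl≡fj
    (ℕ.≤∧≢⇒< (i₀-min _) (λ eq → Fin.punchInᵢ≢i i₀ l (sym (g-inj (Fin.toℕ-injective eq)))))
  inc {suc i} {suc j} (s≤s i<j) = f-inc i<j

  ⇒ : ∀ v → (∃ λ i → f′ i ≡ v) → ∃ λ i → g i ≡ v
  ⇒ v (zero , eq) = i₀ , eq
  ⇒ v (suc i , eq) = let l , eq′ = to (f≃ v) (i , eq) in punchIn i₀ l , eq′

  ⇐ : ∀ v → (∃ λ i → g i ≡ v) → ∃ λ i → f′ i ≡ v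
  ⇐ v (i , eq) with i₀ Fin.≟ i
  ... | yes refl = zero , eq
  ... | no i₀≢i =
    let l , eq′ = from (f≃ v) (punchOut i₀≢i , trans (cong g (Fin.punchIn-punchOut i₀≢i)) eq)
    in suc l , eq′

increasing-first : {f : Fin (suc m) → Fin n} → Increasing f → ∀ i → f zero Fin.≤ f i
increasing-first inc zero    = ℕ.≤-refl
increasing-first inc (suc i) = ℕ.<⇒≤ (inc (s≤s z≤n))

-- The head of an increasing enumeration is the least element of its image, so equal images have
-- equal heads. Strictness keeps the head out of the tail, so the tails have equal images again.
increasing-unique : {f g : Fin m → Fin n} → Increasing f → Increasing g → f ≃ g → f ≗ g
increasing-unique {suc m} {n} {f} {g} f-inc g-inc f≃g = λ
  { zero → heads ; (suc i) → increasing-unique (f-inc ∘ s≤s) (g-inc ∘ s≤s) tails i }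
  where
  heads : f zero ≡ g zero
  heads with to (f≃g _) (zero , refl) | from (f≃g _) (zero , refl)
  ... | i , gi≡f0 | j , fj≡g0 = Fin.toℕ-injective (ℕ.≤-antisym
    (subst (f zero Fin.≤_) fj≡g0 (increasing-first f-inc j))
    (subst (g zero Fin.≤_) gi≡f0 (increasing-first g-inc i)))

  tail-image : {f g : Fin (suc m) → Fin n} → Increasing f → f ≃ g → f zero ≡ g zero →
    ∀ v → (∃ λ i → f (suc i) ≡ v) → ∃ λ i → g (suc i) ≡ v
  tail-image f-inc f≃g f0≡g0 v (i , fi≡v) with to (f≃g v) (suc i , fi≡v)
  ... | suc j , gj≡v = j , gj≡v
  ... | zero , g0≡v = contradiction
    (cong toℕ (trans f0≡g0 (trans g0≡v (sym fi≡v)))) (ℕ.<⇒≢ (f-inc (s≤s z≤n)))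

  tails : (f ∘ suc) ≃ (g ∘ suc)
  tails v = mk⇔ (tail-image f-inc f≃g heads v)
    (tail-image g-inc (λ w → mk⇔ (from (f≃g w)) (to (f≃g w))) (sym heads) v)

increasing-injective : {f : Fin m → Fin n} → Increasing f → Injective _≡_ _≡_ f
increasing-injective inc {i} {j} eq with Fin.<-cmp i j
... | tri< i<j _ _ = contradiction (cong toℕ eq) (ℕ.<⇒≢ (inc i<j))
... | tri≈ _ i≡j _ = i≡j
... | tri> _ _ j<i = contradiction (cong toℕ (sym eq)) (ℕ.<⇒≢ (inc j<i))

-- Cliques

⋀ : (Fin m → Bool) → Bool
⋀ {zero}  p = true
⋀ {suc m} p = p zero ∧ ⋀ (p ∘ suc)

⋀-cong : {p q : Fin m → Bool} → p ≗ q → ⋀ p ≡ ⋀ q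
⋀-cong {zero}  p≗q = refl
⋀-cong {suc m} p≗q = cong₂ _∧_ (p≗q zero) (⋀-cong (p≗q ∘ suc))

⋀-elim : (p : Fin m → Bool) → ⋀ p ≡ true → ∀ i → p i ≡ true
⋀-elim p eq zero    = Bool.∧-conicalˡ _ _ eq
⋀-elim p eq (suc i) = ⋀-elim (p ∘ suc) (Bool.∧-conicalʳ (p zero) _ eq) i

⋀-intro : (p : Fin m → Bool) → (∀ i → p i ≡ true) → ⋀ p ≡ true
⋀-intro {zero}  p all = refl
⋀-intro {suc m} p all = cong₂ _∧_ (all zero) (⋀-intro (p ∘ suc) (all ∘ suc))

⌊⌋-true : {P : Set} (P? : Dec P) → P → ⌊ P? ⌋ ≡ true
⌊⌋-true (yes _) p = refl
⌊⌋-true (no ¬p) p = contradiction p ¬p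

⌊⌋-false : {P : Set} (P? : Dec P) → ¬ P → ⌊ P? ⌋ ≡ false
⌊⌋-false (yes p) ¬p = contradiction p ¬p
⌊⌋-false (no _)  ¬p = refl

⌊⌋-witness : {P : Set} (P? : Dec P) → ⌊ P? ⌋ ≡ true → P
⌊⌋-witness (yes p) _ = p

module Cliques (G : Graph n) where

  arc : Fin n → Fin n → Bool
  arc u v = adj G u v ∧ ⌊ v Fin.<? u ⌋

  -- The increasing cliques. Splitting off the least vertex ℓ makes `chain` of ℓ followed by a tuple
  -- i unfold to `chain i` and the summand at ℓ of the matrix product at i.
  chain : (Fin m → Fin n) → Bool
  chain {zero}  f = true
  chain {suc m} f = chain (f ∘ suc) ∧ ⋀ λ j → arc (f (suc j)) (f zero)

  chain-cong : {f g : Fin m → Fin n} → f ≗ g → chain f ≡ chain g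
  chain-cong {zero}  f≗g = refl
  chain-cong {suc m} f≗g = cong₂ _∧_ (chain-cong (f≗g ∘ suc))
    (⋀-cong λ j → cong₂ arc (f≗g (suc j)) (f≗g zero))

  -- Every pair of positions except the first two lies in one of the two shorter tuples. Their
  -- common tail is tested twice, which idempotence of conjunction absorbs.
  chain-step : (f : Fin (suc (suc m)) → Fin n) →
    chain f ≡ (chain (f ∘ suc) ∧ chain (f zero Vector.∷ λ j → f (suc (suc j)))) ∧ arc (f (suc zero)) (f zero)
  chain-step f = lemma (chain λ j → f (suc (suc j))) (⋀ λ j → arc (f (suc (suc j))) (f (suc zero)))
    (arc (f (suc zero)) (f zero)) (⋀ λ j → arc (f (suc (suc j))) (f zero))
    where
    lemma : ∀ a b c d → (a ∧ b) ∧ (c ∧ d) ≡ ((a ∧ b) ∧ (a ∧ d)) ∧ c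
    lemma false b     c d = refl
    lemma true  false c d = refl
    lemma true  true  c d = Bool.∧-comm c d

  chain-elim : (f : Fin m → Fin n) → chain f ≡ true →
    ∀ {i j} → i Fin.< j → arc (f j) (f i) ≡ true
  chain-elim {suc m} f eq {zero}  {suc j} _ = ⋀-elim _ (Bool.∧-conicalʳ (chain (f ∘ suc)) _ eq) j
  chain-elim {suc m} f eq {suc i} {suc j} (s≤s i<j) =
    chain-elim (f ∘ suc) (Bool.∧-conicalˡ _ _ eq) i<j

  chain-intro : (f : Fin m → Fin n) →
    (∀ {i j} → i Fin.< j → arc (f j) (f i) ≡ true) → chain f ≡ true
  chain-intro {zero}  f arcs = refl
  chain-intro {suc m} f arcs =
    cong₂ _∧_ (chain-intro (f ∘ suc) (arcs ∘ s≤s))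
      (⋀-intro (λ j → arc (f (suc j)) (f zero)) λ j → arcs (s≤s z≤n))

  chain-increasing : (f : Fin m → Fin n) → chain f ≡ true → Increasing f
  chain-increasing f eq {i} {j} i<j =
    ⌊⌋-witness (f i Fin.<? f j) (Bool.∧-conicalʳ (adj G (f j) (f i)) _ (chain-elim f eq i<j))

  chain-adj : (f : Fin m → Fin n) → chain f ≡ true → ∀ i j → i ≢ j → adj G (f i) (f j) ≡ true
  chain-adj f eq i j i≢j with Fin.<-cmp i j
  ... | tri< i<j _ _ = trans (symmetric G _ _) (Bool.∧-conicalˡ _ _ (chain-elim f eq i<j))
  ... | tri≈ _ i≡j _ = contradiction i≡j i≢j
  ... | tri> _ _ j<i = Bool.∧-conicalˡ _ _ (chain-elim f eq j<i)

-- Copies of `K m` as complete subgraphs on increasing tuples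

member : (Fin m → Fin n) → Fin n → Bool
member f v = ⌊ Fin.any? (λ i → f i Fin.≟ v) ⌋

-- The only possible copy of a complete graph on this vertex set: all pairs of distinct members are
-- edges, and nothing else is.
complete : (Fin m → Fin n) → VertexEdgeSet n
complete f = ⟨ Vec.tabulate (member f) , Vec.tabulate (λ u → Vec.tabulate (edges′ u)) ⟩
  where
  edges′ : Fin _ → Fin _ → Bool
  edges′ u v = (member f u ∧ member f v) ∧ not ⌊ u Fin.≟ v ⌋

complete-edge : (f : Fin m → Fin n) → ∀ u v →
  edge (complete f) u v ≡ (member f u ∧ member f v) ∧ not ⌊ u Fin.≟ v ⌋
complete-edge f u v = trans (cong (λ row → lookup row v) (Vec.lookup∘tabulate _ u)) (Vec.lookup∘tabulate _ v)

complete-vertices : (f : Fin m → Fin n) → ∀ v → v ∈ vertices (complete f) ⇔ (∃ λ i → f i ≡ v)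
complete-vertices f v = mk⇔
  (λ v∈ → ⌊⌋-witness (Fin.any? _) (trans (sym (Vec.lookup∘tabulate (member f) v)) (Vec.[]=⇒lookup v∈)))
  (λ v∈ → Vec.lookup⇒[]= v _ (trans (Vec.lookup∘tabulate (member f) v) (⌊⌋-true (Fin.any? _) v∈)))

not-≟-sym : (u v : Fin n) → not ⌊ u Fin.≟ v ⌋ ≡ not ⌊ v Fin.≟ u ⌋
not-≟-sym {n} = symmetric (K n)

vertexEdgeSet-≡ : {H H′ : VertexEdgeSet n} →
  (∀ v → v ∈ vertices H ⇔ v ∈ vertices H′) → (∀ u v → edge H u v ≡ edge H′ u v) → H ≡ H′
vertexEdgeSet-≡ {H = ⟨ V , E ⟩} {⟨ V′ , E′ ⟩} vs es = cong₂ ⟨_,_⟩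
  (⊆-antisym (λ {v} → to (vs v)) (λ {v} → from (vs v)))
  (lookup-injective λ u → lookup-injective (es u))
  where
  lookup-injective : {A : Set} {xs ys : Vec A m} → lookup xs ≗ lookup ys → xs ≡ ys
  lookup-injective {xs = xs} {ys} eq = trans (sym (Vec.tabulate∘lookup xs))
    (trans (Vec.tabulate-cong eq) (Vec.tabulate∘lookup ys))

module Copies (G : Graph n) where
  open Cliques G

  complete-isCopy : (f : Fin m → Fin n) → chain f ≡ true → IsCopyOf (K m) G (complete f)
  complete-isCopy {m} f eq = record
    { edge-sym = λ u v → trans (complete-edge f u v) (trans
        (cong₂ _∧_ (Bool.∧-comm (member f u) (member f v)) (not-≟-sym u v)) (sym (complete-edge f v u)))
    ; edge-end = λ u v e → from (complete-vertices f u) (proj₁ (ends u v e))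
    ; edge-adj = edge-adj′
    } , record
    { to = f
    ; injective = f-inj
    ; image = complete-vertices f
    ; preserves = λ i j → trans (complete-edge f (f i) (f j)) (trans
        (cong₂ (λ a b → (a ∧ b) ∧ not ⌊ f i Fin.≟ f j ⌋)
          (⌊⌋-true (Fin.any? _) (i , refl)) (⌊⌋-true (Fin.any? _) (j , refl)))
        (cong not (same i j)))
    }
    where
    f-inj : Injective _≡_ _≡_ f
    f-inj = increasing-injective (chain-increasing f eq)

    ends : ∀ u v → edge (complete f) u v ≡ true → (∃ λ i → f i ≡ u) × (∃ λ j → f j ≡ v)
    ends u v e = let both = Bool.∧-conicalˡ _ _ (trans (sym (complete-edge f u v)) e) in
      ⌊⌋-witness (Fin.any? _) (Bool.∧-conicalˡ _ _ both) ,
      ⌊⌋-witness (Fin.any? _) (Bool.∧-conicalʳ (member f u) _ both)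

    edge-adj′ : ∀ u v → edge (complete f) u v ≡ true → adj G u v ≡ true
    edge-adj′ u v e with ends u v e
    ... | (i , refl) , (j , refl) = chain-adj f eq i j λ { refl → contradiction
      (trans (sym (trans (complete-edge f (f i) (f i)) (trans
          (cong (λ b → (member f (f i) ∧ member f (f i)) ∧ not b) (⌊⌋-true (f i Fin.≟ f i) refl))
          (Bool.∧-zeroʳ _)))) e)
      λ () }

    same : ∀ i j → ⌊ f i Fin.≟ f j ⌋ ≡ ⌊ i Fin.≟ j ⌋
    same i j with i Fin.≟ j
    ... | yes refl = ⌊⌋-true (f i Fin.≟ f i) refl
    ... | no i≢j = ⌊⌋-false (f i Fin.≟ f j) (i≢j ∘ f-inj)

  -- An embedding of `K m` onto H is determined only up to order; sorting it selects the increasing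
  -- one. H agrees with `complete f` since its edges end in the image, distinct members are joined,
  -- and `preserves i i` excludes loops.
  copy-complete : ∀ {H} → IsCopyOf (K m) G H →
    ∃ λ (f : Fin m → Fin n) → chain f ≡ true × complete f ≡ H
  copy-complete {m} {H} (H⊆G , H≅K) = f , chain-intro f arcs , vertexEdgeSet-≡ verts edgs
    where
    open IsSubgraph H⊆G
    open _≅_ H≅K renaming (to to g)
    sorted = sort g injective
    f = proj₁ sorted
    f-inc = proj₁ (proj₂ sorted)
    f≃g = proj₂ (proj₂ sorted)

    verts : ∀ v → v ∈ vertices (complete f) ⇔ v ∈ vertices H
    verts v = mk⇔ (from (image v) ∘ to (f≃g v) ∘ to (complete-vertices f v))
                  (from (complete-vertices f v) ∘ from (f≃g v) ∘ to (image v))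

    K-adj : ∀ {i j} → i ≢ j → edge H (g i) (g j) ≡ true
    K-adj {i} {j} i≢j = trans (preserves i j) (cong not (⌊⌋-false (i Fin.≟ j) i≢j))

    arcs : ∀ {i j} → i Fin.< j → arc (f j) (f i) ≡ true
    arcs {i} {j} i<j with to (f≃g _) (i , refl) | to (f≃g _) (j , refl)
    ... | a , ga≡fi | b , gb≡fj = cong₂ _∧_
      (subst (λ v → adj G v (f i) ≡ true) gb≡fj (subst (λ v → adj G (g b) v ≡ true) ga≡fi
        (edge-adj _ _ (K-adj λ { refl →
          ℕ.<⇒≢ (f-inc i<j) (cong toℕ (trans (sym ga≡fi) gb≡fj)) }))))
      (⌊⌋-true (f i Fin.<? f j) (f-inc i<j))

    edgs : ∀ u v → edge (complete f) u v ≡ edge H u v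
    edgs u v = trans (complete-edge f u v) (lemma u v)
      where
      lemma : ∀ u v → (member f u ∧ member f v) ∧ not ⌊ u Fin.≟ v ⌋ ≡ edge H u v
      lemma u v with Fin.any? (λ i → f i Fin.≟ u) | Fin.any? (λ i → f i Fin.≟ v)
      ... | no u∉ | _ = sym (Bool.¬-not λ e → u∉ (from (f≃g u) (to (image u) (edge-end u v e))))
      ... | yes _ | no v∉ = sym (Bool.¬-not λ e → v∉ (from (f≃g v) (to (image v)
                              (edge-end v u (trans (edge-sym v u) e)))))
      ... | yes u∈ | yes v∈ with to (f≃g u) u∈ | to (f≃g v) v∈
      ...   | i , refl | j , refl with i Fin.≟ j
      ...     | yes refl = trans (cong not (⌊⌋-true (g i Fin.≟ g i) refl))
                  (sym (trans (preserves i i) (cong not (⌊⌋-true (i Fin.≟ i) refl))))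
      ...     | no i≢j = trans (cong not (⌊⌋-false (g i Fin.≟ g j) (i≢j ∘ injective))) (sym (K-adj i≢j))

  complete-injective : {f g : Fin m → Fin n} → chain f ≡ true → chain g ≡ true →
    complete f ≡ complete g → f ≗ g
  complete-injective {f = f} {g} cf cg eq = increasing-unique
    (chain-increasing f cf) (chain-increasing g cg) λ v → mk⇔
      (to (complete-vertices g v) ∘ subst (λ H → v ∈ vertices H) eq ∘ from (complete-vertices f v))
      (to (complete-vertices f v) ∘ subst (λ H → v ∈ vertices H) (sym eq) ∘ from (complete-vertices g v))

-- Counting by summation

bit : Bool → ℕ
bit false = 0
bit true  = 1

bit-∧ : ∀ a b → bit (a ∧ b) ≡ bit a * bit b
bit-∧ false b = refl
bit-∧ true  b = sym (ℕ.+-identityʳ _)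

module _ {A B : Set} where

  -- Injectivity is asked on `P` only, because `complete` forgets the order of a tuple and is
  -- injective just on chains.
  map-unique : {P : A → Set} (f : A → B) → (∀ {x y} → P x → P y → f x ≡ f y → x ≡ y) →
    {xs : List A} → All P xs → Unique xs → Unique (map f xs)
  map-unique f inj [] [] = []
  map-unique {P} f inj {x ∷ xs} (px ∷ pxs) (x∉xs ∷ uxs) = fresh pxs x∉xs ∷ map-unique f inj pxs uxs
    where
    fresh : ∀ {ys} → All P ys → All (x ≢_) ys → All (f x ≢_) (map f ys)
    fresh [] [] = []
    fresh (py ∷ pys) (x≢y ∷ x∉ys) = (x≢y ∘ inj px py) ∷ fresh pys x∉ys

  -- Stated for arbitrary tabulations instead of `allFin`, because the induction passes from `f` to
  -- `f ∘ suc`.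
  length-filter-product : (p : A × B → Bool) {k l : ℕ} (f : Fin k → A) (g : Fin l → B) →
    length (filter (λ z → p z Bool.≟ true) (cartesianProduct (tabulate f) (tabulate g)))
      ≡ ∑ λ i → ∑ λ j → bit (p (f i , g j))
  length-filter-product p {zero} f g = refl
  length-filter-product p {suc k} f g = begin
    length (filter p? (row ++ rest))                         ≡⟨ cong length (filter-++ p? row rest) ⟩
    length (filter p? row ++ filter p? rest)                 ≡⟨ length-++ (filter p? row) ⟩
    length (filter p? row) + length (filter p? rest)         ≡⟨ cong₂ _+_ (one g) (length-filter-product p (f ∘ suc) g) ⟩
    ∑ (λ i → ∑ λ j → bit (p (f i , g j)))                    ∎
    where
    open ≡-Reasoning
    p? = λ z → p z Bool.≟ true
    row = map (f zero ,_) (tabulate g)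
    rest = cartesianProduct (tabulate (f ∘ suc)) (tabulate g)

    one : ∀ {l} (g : Fin l → B) →
      length (filter p? (map (f zero ,_) (tabulate g))) ≡ ∑ λ j → bit (p (f zero , g j))
    one {zero}  g = refl
    one {suc l} g with p (f zero , g zero)
    ... | true  = cong suc (one (g ∘ suc))
    ... | false = one (g ∘ suc)

module Counting (G : Graph n) (k : ℕ) where
  open Cliques G
  open Copies G

  digits : Fin (n ^ k) → Fin k → Fin n
  digits = finToFun

  commonArcs : (Fin k → Fin n) → ℕ
  commonArcs i = ∑ λ ℓ → bit (⋀ λ j → arc (i j) ℓ)

  cliqueCount : ℕ
  cliqueCount = ∑ λ (t : Fin (n ^ k)) → bit (chain (digits t)) * commonArcs (digits t)

  private
    -- Tuples are listed by their codes: equality of functions is only pointwise here, while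
    -- `Unique` and list membership require propositional equality.
    tuple : Fin (n ^ k) × Fin n → Fin (suc k) → Fin n
    tuple (t , ℓ) = ℓ Vector.∷ digits t

    tuple-injective : ∀ {x y} → tuple x ≗ tuple y → x ≡ y
    tuple-injective {t , ℓ} {t′ , ℓ′} eq = cong₂ _,_
      (trans (sym (Fin.funToFin-finToFin {k} {n} t)) (trans (funToFin-cong (eq ∘ suc)) (Fin.funToFin-finToFin {k} {n} t′)))
      (eq zero)
      where
      funToFin-cong : ∀ {m n} {f g : Fin m → Fin n} → f ≗ g → funToFin f ≡ funToFin g
      funToFin-cong {zero} f≗g = refl
      funToFin-cong {suc m} f≗g = cong₂ Fin.combine (f≗g zero) (funToFin-cong (f≗g ∘ suc))

    chains : List (Fin (n ^ k) × Fin n)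
    chains = filter (λ z → chain (tuple z) Bool.≟ true) (cartesianProduct (allFin (n ^ k)) (allFin n))

  length-chains : length chains ≡ cliqueCount
  length-chains = trans (length-filter-product (chain ∘ tuple) id id) (∑-cong {n = n ^ k} λ t →
    trans (∑-cong {n = n} λ ℓ → bit-∧ (chain (digits t)) (⋀ λ j → arc (digits t j) ℓ))
      (sym (*-distribˡ-∑ {n} (bit (chain (digits t))) λ ℓ → bit (⋀ λ j → arc (digits t j) ℓ))))

  cliqueCount-correct : HasCardinality (IsCopyOf (K (suc k)) G) cliqueCount
  cliqueCount-correct = map (complete ∘ tuple) chains ,
    map-unique (complete ∘ tuple) (λ cx cy → tuple-injective ∘ complete-injective cx cy)
      (all-filter _ (cartesianProduct (allFin (n ^ k)) (allFin n))) (filter⁺ _ (cartesianProduct⁺ (allFin⁺ _) (allFin⁺ _))) ,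
    (λ H → mk⇔ (⇒ H) (⇐ H)) ,
    trans (length-map _ chains) length-chains
    where
    ⇒ : ∀ H → H List.∈ map (complete ∘ tuple) chains → IsCopyOf (K (suc k)) G H
    ⇒ H H∈ with ∈-map⁻ (complete ∘ tuple) H∈
    ... | z , z∈ , refl = complete-isCopy (tuple z)
      (proj₂ (∈-filter⁻ (λ z → chain (tuple z) Bool.≟ true) {xs = cartesianProduct (allFin (n ^ k)) (allFin n)} z∈))

    complete-cong : {f g : Fin m → Fin n} → f ≗ g → complete f ≡ complete g
    complete-cong {f = f} {g} f≗g = cong₂ ⟨_,_⟩ (Vec.tabulate-cong mem)
      (Vec.tabulate-cong λ u → Vec.tabulate-cong λ v → cong₂ (λ a b → (a ∧ b) ∧ _) (mem u) (mem v))
      where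
      mem : member f ≗ member g
      mem v with Fin.any? (λ i → g i Fin.≟ v)
      ... | yes (i , eq) = ⌊⌋-true (Fin.any? _) (i , trans (f≗g i) eq)
      ... | no ∄ = ⌊⌋-false (Fin.any? _) λ (i , eq) → ∄ (i , trans (sym (f≗g i)) eq)

    ⇐ : ∀ H → IsCopyOf (K (suc k)) G H → H List.∈ map (complete ∘ tuple) chains
    ⇐ H copy with copy-complete copy
    ... | f , cf , refl = subst (List._∈ map (complete ∘ tuple) chains) (complete-cong f≗)
      (∈-map⁺ (complete ∘ tuple) (∈-filter⁺ (λ z → chain (tuple z) Bool.≟ true) (∈-cartesianProduct⁺ (∈-allFin t) (∈-allFin (f zero)))
        (trans (chain-cong f≗) cf)))
      where
      t = funToFin (f ∘ suc)
      f≗ : tuple (t , f zero) ≗ f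
      f≗ zero = refl
      f≗ (suc i) = Fin.finToFun-funToFin (f ∘ suc) i

-- Execution of programs

-- A Hoare triple with a time budget. The budget is an upper bound because the running time of the
-- given product program is known only through one.
Runs : ℕ → Program → State → ℕ → (State → Set) → Set
Runs W c s τ Q = ∃ λ s′ → ∃ λ t → (W ⊢ c , s ⇓ s′ , t) × t ≤ τ × Q s′

relax : ∀ {W c s τ υ Q} → τ ≤ υ → Runs W c s τ Q → Runs W c s υ Q
relax τ≤υ (s′ , t , run , t≤τ , q) = s′ , t , run , ℕ.≤-trans t≤τ τ≤υ , q

infixr 5 _⟫_

_⟫_ : ∀ {W c d s τ υ Q R} → Runs W c s τ Q → (∀ s′ → Q s′ → Runs W d s′ υ R) →
  Runs W (c ⨾ d) s (τ + υ) R
(s′ , t , run , t≤τ , q) ⟫ next with next s′ q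
... | s″ , u , run′ , u≤υ , r = s″ , t + u , seq run run′ , ℕ.+-mono-≤ t≤τ u≤υ , r

infixr 5 _▹_

-- For a first command with an explicit end state: later register and cell contents are then found
-- by computation instead of through a postcondition.
_▹_ : ∀ {W c d s s′ t τ Q} → W ⊢ c , s ⇓ s′ , t → Runs W d s′ τ Q → Runs W (c ⨾ d) s (t + τ) Q
run ▹ (s″ , u , run′ , u≤τ , q) = s″ , _ , seq run run′ , ℕ.+-monoʳ-≤ _ u≤τ , q

once : ∀ {W c s s′ t Q} → W ⊢ c , s ⇓ s′ , t → Q s′ → Runs W c s t Q
once run q = _ , _ , run , ℕ.≤-refl , q

weaken : ∀ {W c s τ} {Q R : State → Set} → (∀ s′ → Q s′ → R s′) → Runs W c s τ Q → Runs W c s τ R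
weaken Q⇒R (s′ , t , run , t≤τ , q) = s′ , t , run , t≤τ , Q⇒R s′ q

-- The index of the invariant is the number of iterations left. Each iteration pays one step for its
-- test; the leading `suc` pays for the test that fails.
countdown : ∀ {W body τ x} (Inv : ℕ → State → Set) →
  (∀ i s → Inv i s → regs s x ≡ + i) →
  (∀ i s → Inv (suc i) s → Runs W body s τ (Inv i)) →
  ∀ i s → Inv i s → Runs W (WHILE lit 0ℤ < reg x DO body) s (suc (i * suc τ)) (Inv 0)
countdown Inv counter step zero s inv =
  s , 1 , while-false (λ 0<x → ℤ.<-irrefl refl (subst (0ℤ ℤ.<_) (counter 0 s inv) 0<x)) , s≤s z≤n , inv
countdown Inv counter step (suc i) s inv with step i s inv
... | s′ , t , run , t≤τ , inv′ with countdown Inv counter step i s′ inv′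
...   | s″ , u , runs , u≤ , inv″ =
  s″ , suc (t + u) ,
  while-true (subst (0ℤ ℤ.<_) (sym (counter (suc i) s inv)) (ℤ.+<+ (s≤s z≤n))) run runs ,
  s≤s (ℕ.≤-trans (ℕ.+-mono-≤ t≤τ u≤) (ℕ.≤-reflexive (ℕ.+-suc _ _))) , inv″

read-same : ∀ a i v s → arrays (setCell a i v s) a i ≡ v
read-same a i v s
  rewrite ⌊⌋-true (a ℕ.≟ a) refl | ⌊⌋-true (i ℕ.≟ i) refl = refl

read-other-index : ∀ a b {i j} v s → i ≢ j → arrays (setCell a i v s) b j ≡ arrays s b j
read-other-index a b {i} {j} v s i≢j with ⌊ a ℕ.≟ b ⌋
... | false = refl
... | true rewrite ⌊⌋-false (i ℕ.≟ j) i≢j = refl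

read-other-array : ∀ {a b} i j v s → a ≢ b → arrays (setCell a i v s) b j ≡ arrays s b j
read-other-array {a} {b} i j v s a≢b rewrite ⌊⌋-false (a ℕ.≟ b) a≢b = refl

-- Together with `apply-sub` this decodes positions: `combine x y` is x * n + y, with quotient x and
-- remainder y.
apply-div : ∀ {i} q d r → i ≡ q * d + r → r < d → apply div (+ i) (+ d) ≡ + q
apply-div {i} q d@(suc d-1) r i≡ r<d = trans (ℤ.div-pos-is-/ℕ (+ i) d) (cong +_ quotient)
  where
  open ≡-Reasoning
  quotient : i ℕ./ d ≡ q
  quotient = begin
    i ℕ./ d                ≡⟨ cong (ℕ._/ d) i≡ ⟩
    (q * d + r) ℕ./ d      ≡⟨ ℕ.+-distrib-/-∣ˡ r (divides-refl q) ⟩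
    q * d ℕ./ d + r ℕ./ d  ≡⟨ cong₂ _+_ (ℕ.m*n/n≡m q d) (ℕ.m<n⇒m/n≡0 r<d) ⟩
    q + 0                  ≡⟨ ℕ.+-identityʳ q ⟩
    q                      ∎

apply-sub : ∀ {i} p r → i ≡ p + r → apply sub (+ i) (+ p) ≡ + r
apply-sub {i} p r i≡ = begin
  + i ℤ.- + p          ≡⟨ cong (λ j → + j ℤ.- + p) i≡ ⟩
  + (p + r) ℤ.- + p    ≡⟨ ℤ.m-n≡m⊖n (p + r) p ⟩
  (p + r) ℤ.⊖ p        ≡⟨ ℤ.⊖-≥ (ℕ.m≤m+n p r) ⟩
  + (p + r ∸ p)        ≡⟨ cong +_ (ℕ.m+n∸m≡n p r) ⟩
  + r                  ∎
  where open ≡-Reasoning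

apply-mul : ∀ m n → apply mul (+ m) (+ n) ≡ + (m * n)
apply-mul m n = sym (ℤ.pos-* m n)

-- Relocation of a program past the first ten registers and arrays, so that n
-- and the oriented matrix survive a product program that expects all other
-- cells to be zero and may overwrite everything it can reach.

shiftOperand : Operand → Operand
shiftOperand (reg x) = reg (10 + x)
shiftOperand (lit z) = lit z

shift : Program → Program
shift skip                       = skip
shift (x ≔ e ⟨ o ⟩ f)            = (10 + x) ≔ shiftOperand e ⟨ o ⟩ shiftOperand f
shift (x ≔ a [ e ])              = (10 + x) ≔ 10 + a [ shiftOperand e ]
shift (a [ e ]≔ f)               = (10 + a) [ shiftOperand e ]≔ shiftOperand f
shift (c ⨾ d)                    = shift c ⨾ shift d
shift (IF e < f THEN c ELSE d)   = IF shiftOperand e < shiftOperand f THEN shift c ELSE shift d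
shift (WHILE e < f DO c)         = WHILE shiftOperand e < shiftOperand f DO shift c

record _∼_ (s s′ : State) : Set where
  field
    same-regs   : ∀ x → regs s x ≡ regs s′ (10 + x)
    same-arrays : ∀ a i → arrays s a i ≡ arrays s′ (10 + a) i

-- All other low cells are written before they are read again, so n and the oriented matrix suffice.
record Unchanged (s s′ : State) : Set where
  field
    same-reg₀ : regs s′ 0 ≡ regs s 0
    same-arr₀ : ∀ i → arrays s′ 0 i ≡ arrays s 0 i

open _∼_
open Unchanged

Unchanged-refl : ∀ {s} → Unchanged s s
Unchanged-refl = record { same-reg₀ = refl ; same-arr₀ = λ _ → refl }

Unchanged-trans : ∀ {s s′ s″} → Unchanged s s′ → Unchanged s′ s″ → Unchanged s s″
Unchanged-trans u v = record
  { same-reg₀ = trans (same-reg₀ v) (same-reg₀ u)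
  ; same-arr₀ = λ i → trans (same-arr₀ v i) (same-arr₀ u i)
  }

shift-value : ∀ {s s′} e → s ∼ s′ → ⟦ shiftOperand e ⟧ s′ ≡ ⟦ e ⟧ s
shift-value (reg x) s∼s′ = sym (same-regs s∼s′ x)
shift-value (lit z) s∼s′ = refl

-- On `does` the two comparisons agree by computation, so `⌊_⌋` is first replaced by it.
shift-≟ : ∀ x y → ⌊ 10 + x ℕ.≟ 10 + y ⌋ ≡ ⌊ x ℕ.≟ y ⌋
shift-≟ x y = trans (isYes≗does (10 + x ℕ.≟ 10 + y)) (sym (isYes≗does (x ℕ.≟ y)))

shift-setReg : ∀ {s s′} x v → s ∼ s′ → setReg x v s ∼ setReg (10 + x) v s′
shift-setReg x v s∼s′ = record
  { same-regs   = λ y → cong₂ (if_then v else_) (sym (shift-≟ x y)) (same-regs s∼s′ y)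
  ; same-arrays = same-arrays s∼s′
  }

shift-setCell : ∀ {s s′} a i v → s ∼ s′ → setCell a i v s ∼ setCell (10 + a) i v s′
shift-setCell a i v s∼s′ = record
  { same-regs   = same-regs s∼s′
  ; same-arrays = λ b j → cong₂
      (λ c z → if c then (if ⌊ i ℕ.≟ j ⌋ then v else z) else z) (sym (shift-≟ a b)) (same-arrays s∼s′ b j)
  }

shift-< : ∀ {s s′} e f → s ∼ s′ → ⟦ e ⟧ s ℤ.< ⟦ f ⟧ s → ⟦ shiftOperand e ⟧ s′ ℤ.< ⟦ shiftOperand f ⟧ s′
shift-< e f s∼s′ rewrite shift-value e s∼s′ | shift-value f s∼s′ = id

shift-≮ : ∀ {s s′} e f → s ∼ s′ → ¬ (⟦ e ⟧ s ℤ.< ⟦ f ⟧ s) →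
  ¬ (⟦ shiftOperand e ⟧ s′ ℤ.< ⟦ shiftOperand f ⟧ s′)
shift-≮ e f s∼s′ rewrite shift-value e s∼s′ | shift-value f s∼s′ = id

-- Induction on the derivation. Relocation keeps the number of steps, and every write lands on a
-- name of at least ten. The word bound may grow, since counting uses larger words than the product.
shift-run : ∀ {V W c s t s₁ s′} → V ≤ W → V ⊢ c , s ⇓ s₁ , t → s ∼ s′ →
  ∃ λ s₁′ → (W ⊢ shift c , s′ ⇓ s₁′ , t) × s₁ ∼ s₁′ × Unchanged s′ s₁′
shift-run V≤W skip s∼s′ = _ , skip , s∼s′ , Unchanged-refl
shift-run V≤W (assign {x = x} {e} {o} {f} {v} eq v≤V) s∼s′ =
  _ , assign (trans (cong₂ (apply o) (shift-value e s∼s′) (shift-value f s∼s′)) eq) (ℕ.≤-trans v≤V V≤W) ,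
  shift-setReg x v s∼s′ , record { same-reg₀ = refl ; same-arr₀ = λ _ → refl }
shift-run V≤W (load {x = x} {a} {e} {i} {v} eq read v≤V) s∼s′ =
  _ , load (trans (shift-value e s∼s′) eq) (trans (sym (same-arrays s∼s′ a i)) read) (ℕ.≤-trans v≤V V≤W) ,
  shift-setReg x v s∼s′ , record { same-reg₀ = refl ; same-arr₀ = λ _ → refl }
shift-run V≤W (store {a = a} {e} {f} {i} {v} eq eq′ v≤V) s∼s′ =
  _ , store (trans (shift-value e s∼s′) eq) (trans (shift-value f s∼s′) eq′) (ℕ.≤-trans v≤V V≤W) ,
  shift-setCell a i v s∼s′ , record { same-reg₀ = refl ; same-arr₀ = λ _ → refl }
shift-run V≤W (seq run₁ run₂) s∼s′ =
  let _ , run₁′ , s₁∼ , u₁ = shift-run V≤W run₁ s∼s′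
      _ , run₂′ , s₂∼ , u₂ = shift-run V≤W run₂ s₁∼
  in _ , seq run₁′ run₂′ , s₂∼ , Unchanged-trans u₁ u₂
shift-run V≤W (if-true {e} {f} e<f run) s∼s′ =
  let _ , run′ , s₁∼ , u = shift-run V≤W run s∼s′
  in _ , if-true (shift-< e f s∼s′ e<f) run′ , s₁∼ , u
shift-run V≤W (if-false {e} {f} e≮f run) s∼s′ =
  let _ , run′ , s₁∼ , u = shift-run V≤W run s∼s′
  in _ , if-false (shift-≮ e f s∼s′ e≮f) run′ , s₁∼ , u
shift-run V≤W (while-true {e} {f} e<f run₁ run₂) s∼s′ =
  let _ , run₁′ , s₁∼ , u₁ = shift-run V≤W run₁ s∼s′
      _ , run₂′ , s₂∼ , u₂ = shift-run V≤W run₂ s₁∼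
  in _ , while-true (shift-< e f s∼s′ e<f) run₁′ run₂′ , s₂∼ , Unchanged-trans u₁ u₂
shift-run V≤W (while-false {e} {f} e≮f) s∼s′ =
  _ , while-false (shift-≮ e f s∼s′ e≮f) , s∼s′ , Unchanged-refl

-- The clique counting program. Register 0 holds n, register 1 the loop counter,
-- register 7 the power n ^ j and register 8 the sum; array 0 holds the matrix
-- (first of the graph, then oriented) and array 1 the indicator table of the
-- increasing cliques on j + 1 vertices. The relocated product finds its input in
-- register 10 and arrays 10 , … , 9 + k, and leaves D in array 10 + k.

-- Array names belong to the program text and cannot be computed, so the copies are made by
-- straight-line code whose length depends on r alone.
broadcast : ℕ → Program
broadcast zero    = skip
broadcast (suc k) = broadcast k ⨾ ((10 + k) [ reg 1 ]≔ reg 4)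

orientBody : ℕ → Program
orientBody k =
  (1 ≔ reg 1 ⟨ sub ⟩ lit 1ℤ) ⨾
  (2 ≔ reg 1 ⟨ div ⟩ reg 0) ⨾
  (3 ≔ reg 2 ⟨ mul ⟩ reg 0) ⨾
  (3 ≔ reg 1 ⟨ sub ⟩ reg 3) ⨾
  (4 ≔ 0 [ reg 1 ]) ⨾
  -- Register 2 holds the row, register 3 the column: an entry survives only below the diagonal.
  (IF reg 3 < reg 2 THEN skip ELSE (4 ≔ lit 0ℤ ⟨ add ⟩ lit 0ℤ)) ⨾
  (0 [ reg 1 ]≔ reg 4) ⨾
  broadcast k

orient : ℕ → Program
orient k =
  (1 ≔ reg 0 ⟨ mul ⟩ reg 0) ⨾
  (WHILE lit 0ℤ < reg 1 DO orientBody k) ⨾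
  (10 ≔ reg 0 ⟨ add ⟩ lit 0ℤ)

singletonsBody : Program
singletonsBody =
  (1 ≔ reg 1 ⟨ sub ⟩ lit 1ℤ) ⨾
  (1 [ reg 1 ]≔ lit 1ℤ)

singletons : Program
singletons =
  (7 ≔ lit 1ℤ ⟨ add ⟩ lit 0ℤ) ⨾
  (1 ≔ reg 0 ⟨ add ⟩ lit 0ℤ) ⨾
  (WHILE lit 0ℤ < reg 1 DO singletonsBody)

-- The position codes x, y, z in base n, where z has j digits. Registers 2 and 3 receive the codes
-- of (x, y) and z, registers 4 and 5 the digits x and y. Register 9 multiplies the entries for (y,
-- z), for (x, z) and for the arc from y to x, following `chain-step`.
extendBody : Program
extendBody =
  (1 ≔ reg 1 ⟨ sub ⟩ lit 1ℤ) ⨾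
  (2 ≔ reg 1 ⟨ div ⟩ reg 7) ⨾
  (3 ≔ reg 2 ⟨ mul ⟩ reg 7) ⨾
  (3 ≔ reg 1 ⟨ sub ⟩ reg 3) ⨾
  (4 ≔ reg 2 ⟨ div ⟩ reg 0) ⨾
  (5 ≔ reg 4 ⟨ mul ⟩ reg 0) ⨾
  (5 ≔ reg 2 ⟨ sub ⟩ reg 5) ⨾
  (6 ≔ reg 5 ⟨ mul ⟩ reg 7) ⨾
  (6 ≔ reg 6 ⟨ add ⟩ reg 3) ⨾
  (9 ≔ 1 [ reg 6 ]) ⨾
  (6 ≔ reg 4 ⟨ mul ⟩ reg 7) ⨾
  (6 ≔ reg 6 ⟨ add ⟩ reg 3) ⨾
  (6 ≔ 1 [ reg 6 ]) ⨾
  (9 ≔ reg 9 ⟨ mul ⟩ reg 6) ⨾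
  (6 ≔ reg 5 ⟨ mul ⟩ reg 0) ⨾
  (6 ≔ reg 6 ⟨ add ⟩ reg 4) ⨾
  (6 ≔ 0 [ reg 6 ]) ⨾
  (9 ≔ reg 9 ⟨ mul ⟩ reg 6) ⨾
  (1 [ reg 1 ]≔ reg 9)

extend : Program
extend =
  (1 ≔ reg 0 ⟨ mul ⟩ reg 0) ⨾
  (1 ≔ reg 1 ⟨ mul ⟩ reg 7) ⨾
  (WHILE lit 0ℤ < reg 1 DO extendBody) ⨾
  (7 ≔ reg 0 ⟨ mul ⟩ reg 7)

tabulateChains : ℕ → Program
tabulateChains zero    = singletons
tabulateChains (suc j) = tabulateChains j ⨾ extend

totalBody : ℕ → Program
totalBody k =
  (1 ≔ reg 1 ⟨ sub ⟩ lit 1ℤ) ⨾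
  (2 ≔ 1 [ reg 1 ]) ⨾
  (3 ≔ 10 + k [ reg 1 ]) ⨾
  (2 ≔ reg 2 ⟨ mul ⟩ reg 3) ⨾
  (8 ≔ reg 8 ⟨ add ⟩ reg 2)

total : ℕ → Program
total k =
  (8 ≔ lit 0ℤ ⟨ add ⟩ lit 0ℤ) ⨾
  (1 ≔ reg 0 ⟨ mul ⟩ reg 7) ⨾
  (WHILE lit 0ℤ < reg 1 DO totalBody k) ⨾
  (0 ≔ reg 8 ⟨ add ⟩ lit 0ℤ)

countCliques : ℕ → Program → Program
countCliques m P =
  orient (2 + m) ⨾
  shift P ⨾
  -- The argument counts extensions of the one-vertex table, so the cliques have 2 + m = r - 1
  -- vertices.
  tabulateChains (suc m) ⨾
  total (2 + m)

-- Correctness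

toℕ-combine′ : (x : Fin m) (y : Fin n) → toℕ (combine x y) ≡ toℕ x * n + toℕ y
toℕ-combine′ {n = n} x y = trans (Fin.toℕ-combine x y) (cong (_+ toℕ y) (ℕ.*-comm n (toℕ x)))

bit≤1 : ∀ b → bit b ≤ 1
bit≤1 false = z≤n
bit≤1 true  = s≤s z≤n

∑-bound : ∀ {b} (f : Fin m → ℕ) → (∀ i → f i ≤ b) → ∑ f ≤ m * b
∑-bound {zero}  f f≤b = z≤n
∑-bound {suc m} f f≤b = ℕ.+-mono-≤ (f≤b zero) (∑-bound (f ∘ suc) (f≤b ∘ suc))

-- The descending loop handles the largest index first, so sums are split at their end.
∑-snoc : ∀ i (c : ℕ → ℕ) → ∑ {suc i} (c ∘ toℕ) ≡ ∑ {i} (c ∘ toℕ) + c i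
∑-snoc i c = trans (∑-init-last {i} (c ∘ toℕ)) (cong₂ _+_
  (∑-cong {i} λ t → cong c (Fin.toℕ-inject₁ t)) (cong c (Fin.toℕ-fromℕ i)))

∏-bit : (p : Fin m → Bool) → ∏ℤ (λ i → + bit (p i)) ≡ + bit (⋀ p)
∏-bit {zero}  p = refl
∏-bit {suc m} p = trans (cong (λ z → + bit (p zero) ℤ.* z) (∏-bit (p ∘ suc)))
  (trans (apply-mul (bit (p zero)) _) (cong +_ (sym (bit-∧ (p zero) _))))

∑-pos : (f : Fin m → ℕ) → ∑ℤ (λ i → + f i) ≡ + ∑ f
∑-pos {zero}  f = refl
∑-pos {suc m} f = cong (λ z → + f zero ℤ.+ z) (∑-pos (f ∘ suc))

record Broadcast (k i : ℕ) (v : ℤ) (s s′ : State) : Set where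
  field
    kept-regs : regs s′ ≡ regs s
    kept-arr₀ : ∀ j → arrays s′ 0 j ≡ arrays s 0 j
    written   : ∀ a → a < k → arrays s′ (10 + a) i ≡ v
    elsewhere : ∀ a j → i ≢ j → arrays s′ (10 + a) j ≡ arrays s (10 + a) j
    beyond    : ∀ a j → k ≤ a → arrays s′ (10 + a) j ≡ arrays s (10 + a) j

10+-injective : ∀ {a b} → 10 + a ≡ 10 + b → a ≡ b
10+-injective = ℕ.+-cancelˡ-≡ 10 _ _

broadcast-run : ∀ {W i v} k s → regs s 1 ≡ + i → regs s 4 ≡ v → ∣ v ∣ ≤ W →
  Runs W (broadcast k) s (suc k) (Broadcast k i v s)
broadcast-run zero s _ _ _ = once skip record
  { kept-regs = refl ; kept-arr₀ = λ _ → refl ; written = λ _ ()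
  ; elsewhere = λ _ _ _ → refl ; beyond = λ _ _ _ → refl }
broadcast-run {W} {i} {v} (suc k) s r₁ r₄ v≤W = relax (ℕ.≤-reflexive (ℕ.+-comm (suc k) 1))
  (broadcast-run k s r₁ r₄ v≤W ⟫ λ s′ b → let open Broadcast b in
    once (store (trans (cong (λ ρ → ρ 1) kept-regs) r₁) (trans (cong (λ ρ → ρ 4) kept-regs) r₄) v≤W) record
      { kept-regs = kept-regs
      ; kept-arr₀ = kept-arr₀
      ; written = λ a a≤k → written′ s′ written a (ℕ.m≤n⇒m<n∨m≡n (ℕ.≤-pred a≤k))
      ; elsewhere = λ a j i≢j → trans (read-other-index (10 + k) (10 + a) v s′ i≢j) (elsewhere a j i≢j)
      ; beyond = λ a j k<a → trans
          (read-other-array i j v s′ (ℕ.<⇒≢ k<a ∘ 10+-injective)) (beyond a j (ℕ.<⇒≤ k<a))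
      })
  where
  written′ : ∀ s′ → (∀ a → a < k → arrays s′ (10 + a) i ≡ v) → ∀ a → a < k ⊎ a ≡ k →
    arrays (setCell (10 + k) i v s′) (10 + a) i ≡ v
  written′ s′ written a (inj₁ a<k) =
    trans (read-other-array i i v s′ (ℕ.<⇒≢ a<k ∘ sym ∘ 10+-injective)) (written a a<k)
  written′ s′ written a (inj₂ refl) = read-same (10 + k) i v s′

-- In units of `M`, where a loop with a body of τ steps costs 2 + τ: two assignments and a body of 2
-- steps give 6, three assignments and a body of 19 steps give 24.
tabulateCost : ℕ → ℕ
tabulateCost zero    = 6
tabulateCost (suc j) = tabulateCost j + 24

-- `M` bounds every position and loop length. Words must hold n * M because the result sums n ^ k
-- entries, each at most n.
module Correctness {n : ℕ} (G : Graph n) (m W M : ℕ) (1≤M : 1 ≤ M)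
  (powers≤M : ∀ j → j ≤ 2 + m → n ^ j ≤ M) (M≤W : M ≤ W) (n*M≤W : n * M ≤ W) where

  open Cliques G

  k : ℕ
  k = 2 + m

  open Counting G k

  arcMatrix : Matrix n
  arcMatrix u v = + bit (arc u v)

  cell : Fin n → Fin n → ℕ
  cell u v = toℕ (combine u v)

  dimProduct-arcs : (i : Fin k → Fin n) → dimProduct (λ _ → arcMatrix) i ≡ + commonArcs i
  dimProduct-arcs i = trans (∑ℤ-cong {n} λ ℓ → ∏-bit λ j → arc (i j) ℓ) (∑-pos {n} _)

  c≤M*_ : ∀ c → c ≤ M * c
  c≤M* c = ℕ.≤-trans (ℕ.≤-reflexive (sym (ℕ.*-identityˡ c))) (ℕ.*-monoˡ-≤ c 1≤M)

  infixr 5 _⨟_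

  -- Sequencing with time in units of `M`, so that the costs of the parts add as constants.
  _⨟_ : ∀ {c d s a b Q R} → Runs W c s (M * a) Q → (∀ s′ → Q s′ → Runs W d s′ (M * b) R) →
    Runs W (c ⨾ d) s (M * (a + b)) R
  run ⨟ next = relax (ℕ.≤-reflexive (sym (ℕ.*-distribˡ-+ M _ _))) (run ⟫ next)

  single : ∀ {c s s′ t Q} → W ⊢ c , s ⇓ s′ , t → Q s′ → Runs W c s (M * t) Q
  single run q = relax (c≤M* _) (once run q)

  infixr 5 _▸_

  _▸_ : ∀ {c d s s′ t b Q} → W ⊢ c , s ⇓ s′ , t → Runs W d s′ (M * b) Q → Runs W (c ⨾ d) s (M * (t + b)) Q
  _▸_ {s′ = s′} run next = single {Q = s′ ≡_} run refl ⨟ λ { _ refl → next }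

  -- The iterations take at most M * (1 + τ) steps; the failing test is charged to one further `M`.
  loop : ∀ {body τ} (Inv : ℕ → State → Set) →
    (∀ i s → Inv i s → regs s 1 ≡ + i) →
    (∀ i s → Inv (suc i) s → Runs W body s τ (Inv i)) →
    ∀ i → i ≤ M → ∀ s → Inv i s → Runs W (WHILE lit 0ℤ < reg 1 DO body) s (M * (2 + τ)) (Inv 0)
  loop {τ = τ} Inv counter step i i≤M s inv =
    relax (ℕ.≤-trans (ℕ.+-mono-≤ 1≤M (ℕ.*-monoˡ-≤ (suc τ) i≤M)) (ℕ.≤-reflexive (sym (ℕ.*-suc M (suc τ)))))
      (countdown Inv counter step i s inv)

  1≤W : 1 ≤ W
  1≤W = ℕ.≤-trans 1≤M M≤W

  n≤M : n ≤ M
  n≤M = subst (_≤ M) (ℕ.*-identityʳ n) (powers≤M 1 (s≤s z≤n))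

  n*n≤M : n * n ≤ M
  n*n≤M = subst (λ z → n * z ≤ M) (ℕ.*-identityʳ n) (powers≤M 2 (s≤s (s≤s z≤n)))

  small : ∀ {a} → a ≤ M → a ≤ W
  small a≤M = ℕ.≤-trans a≤M M≤W

  bit≤W : ∀ b → bit b ≤ W
  bit≤W b = ℕ.≤-trans (bit≤1 b) 1≤W

  n≤W : n ≤ W
  n≤W = small n≤M

  cell<n*n : ∀ u v → cell u v < n * n
  cell<n*n u v = Fin.toℕ<n (combine u v)

  cell≤W : ∀ u v → cell u v ≤ W
  cell≤W u v = small (ℕ.≤-trans (ℕ.<⇒≤ (cell<n*n u v)) n*n≤M)

  -- Orienting the matrix in place

  record Oriented (i : ℕ) (s : State) : Set where
    field
      size     : regs s 0 ≡ + n
      counter  : regs s 1 ≡ + i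
      bounded  : i ≤ n * n
      -- With `padding` and `others`, this keeps zero all cells that the product will see outside
      -- its matrices.
      idle     : ∀ x → regs s (10 + x) ≡ 0ℤ
      unread   : ∀ u v → cell u v < i → arrays s 0 (cell u v) ≡ adjacencyMatrix G u v
      oriented : ∀ u v → i ≤ cell u v → arrays s 0 (cell u v) ≡ arcMatrix u v
      copies   : ∀ a u v → a < k → i ≤ cell u v → arrays s (10 + a) (cell u v) ≡ arcMatrix u v
      padding  : ∀ a j → n * n ≤ j → arrays s (10 + a) j ≡ 0ℤ
      others   : ∀ a j → k ≤ a → arrays s (10 + a) j ≡ 0ℤ

  orient-step : ∀ u v s → Oriented (suc (cell u v)) s →
    Runs W (orientBody k) s (9 + k) (Oriented (cell u v))
  orient-step u v s inv =
    assign {v = + i} (cong (ℤ._- 1ℤ) counter) i≤W ▹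
    assign {v = + U} (trans (cong (apply div (+ i)) size) (apply-div U n V i≡ (Fin.toℕ<n v))) U≤W ▹
    assign {v = + (U * n)} (trans (cong (λ z → + U ℤ.* z) size) (apply-mul U n)) U*n≤W ▹
    assign {v = + V} (apply-sub (U * n) V i≡) V≤W ▹
    load refl (unread u v ℕ.≤-refl) adj≤W ▹
    -- The end state now depends on the graph, so from here on it is known only through `After`.
    branch _ (refl , refl) refl size refl idle refl ⟫ λ s₁ (r₄ , r₀ , r₁ , rₓ , same) →
    store {i = i} r₁ r₄ (bit≤W (arc u v)) ▹
    weaken (finish s₁ r₀ r₁ rₓ same) (broadcast-run k _ r₁ r₄ (bit≤W (arc u v)))
    where
    open Oriented inv
    i = cell u v
    U = toℕ u
    V = toℕ v
    i≡ = toℕ-combine′ u v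
    i≤W = cell≤W u v
    U*n≤W = ℕ.≤-trans (ℕ.m≤m+n (U * n) V) (ℕ.≤-trans (ℕ.≤-reflexive (sym i≡)) i≤W)
    U≤W = ℕ.≤-trans (ℕ.<⇒≤ (Fin.toℕ<n u)) n≤W
    V≤W = ℕ.≤-trans (ℕ.<⇒≤ (Fin.toℕ<n v)) n≤W

    adj≤W : ∣ adjacencyMatrix G u v ∣ ≤ W
    adj≤W with adj G u v
    ... | false = z≤n
    ... | true  = 1≤W

    After : State → Set
    After s′ = regs s′ 4 ≡ arcMatrix u v × regs s′ 0 ≡ + n × regs s′ 1 ≡ + i ×
      (∀ x → regs s′ (10 + x) ≡ 0ℤ) × arrays s′ ≡ arrays s

    branch : ∀ s′ → regs s′ 3 ≡ + V × regs s′ 2 ≡ + U → regs s′ 4 ≡ adjacencyMatrix G u v → regs s′ 0 ≡ + n →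
      regs s′ 1 ≡ + i → (∀ x → regs s′ (10 + x) ≡ 0ℤ) → arrays s′ ≡ arrays s →
      Runs W (IF reg 3 < reg 2 THEN skip ELSE (4 ≔ lit 0ℤ ⟨ add ⟩ lit 0ℤ)) s′ 2 After
    branch s′ (r₃ , r₂) r₄ r₀ r₁ rₓ same with v Fin.<? u
    ... | yes v<u = once (if-true (subst₂ ℤ._<_ (sym r₃) (sym r₂) (ℤ.+<+ v<u)) skip)
      (trans r₄ matches , r₀ , r₁ , rₓ , same)
      where
      matches : adjacencyMatrix G u v ≡ + bit (adj G u v ∧ true)
      matches with adj G u v
      ... | false = refl
      ... | true  = refl
    ... | no v≮u = once (if-false (λ lt → v≮u (ℤ.drop‿+<+ (subst₂ ℤ._<_ r₃ r₂ lt))) (assign refl z≤n))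
      (cong (+_ ∘ bit) (sym (Bool.∧-zeroʳ (adj G u v))) , r₀ , r₁ , rₓ , same)

    finish : ∀ s₁ → regs s₁ 0 ≡ + n → regs s₁ 1 ≡ + i → (∀ x → regs s₁ (10 + x) ≡ 0ℤ) →
      arrays s₁ ≡ arrays s → ∀ s′ → Broadcast k i (arcMatrix u v) (setCell 0 i (arcMatrix u v) s₁) s′ →
      Oriented i s′
    finish s₁ r₀ r₁ rₓ same s′ b = record
      { size     = trans (cong (λ ρ → ρ 0) kept-regs) r₀
      ; counter  = trans (cong (λ ρ → ρ 1) kept-regs) r₁
      ; bounded  = ℕ.<⇒≤ bounded
      ; idle     = λ x → trans (cong (λ ρ → ρ (10 + x)) kept-regs) (rₓ x)
      ; unread   = λ u′ v′ c<i → trans (arr₀ _ (ℕ.<⇒≢ c<i ∘ sym)) (unread u′ v′ (ℕ.m<n⇒m<1+n c<i))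
      ; oriented = λ u′ v′ i≤c → oriented′ u′ v′ (ℕ.m≤n⇒m<n∨m≡n i≤c)
      ; copies   = λ a u′ v′ a<k i≤c → copies′ a u′ v′ a<k (ℕ.m≤n⇒m<n∨m≡n i≤c)
      ; padding  = λ a j n*n≤j → trans (arr a j (ℕ.<⇒≢ (ℕ.<-≤-trans (cell<n*n u v) n*n≤j))) (padding a j n*n≤j)
      ; others   = λ a j k≤a → trans (beyond a j k≤a) (trans (cong (λ A → A (10 + a) j) same) (others a j k≤a))
      }
      where
      open Broadcast b

      arr₀ : ∀ j → i ≢ j → arrays s′ 0 j ≡ arrays s 0 j
      arr₀ j i≢j = trans (kept-arr₀ j)
        (trans (read-other-index 0 0 (arcMatrix u v) s₁ i≢j) (cong (λ A → A 0 j) same))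

      arr : ∀ a j → i ≢ j → arrays s′ (10 + a) j ≡ arrays s (10 + a) j
      arr a j i≢j = trans (elsewhere a j i≢j) (cong (λ A → A (10 + a) j) same)

      here′ : ∀ u′ v′ → i ≡ cell u′ v′ → arcMatrix u v ≡ arcMatrix u′ v′
      here′ u′ v′ eq with Fin.combine-injective u v u′ v′ (Fin.toℕ-injective eq)
      ... | refl , refl = refl

      oriented′ : ∀ u′ v′ → i < cell u′ v′ ⊎ i ≡ cell u′ v′ → arrays s′ 0 (cell u′ v′) ≡ arcMatrix u′ v′
      oriented′ u′ v′ (inj₁ i<c) = trans (arr₀ _ (ℕ.<⇒≢ i<c)) (oriented u′ v′ i<c)
      oriented′ u′ v′ (inj₂ i≡c) = trans (cong (arrays s′ 0) (sym i≡c))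
        (trans (kept-arr₀ i) (trans (read-same 0 i (arcMatrix u v) s₁) (here′ u′ v′ i≡c)))

      copies′ : ∀ a u′ v′ → a < k → i < cell u′ v′ ⊎ i ≡ cell u′ v′ →
        arrays s′ (10 + a) (cell u′ v′) ≡ arcMatrix u′ v′
      copies′ a u′ v′ a<k (inj₁ i<c) = trans (arr a _ (ℕ.<⇒≢ i<c)) (copies a u′ v′ a<k i<c)
      copies′ a u′ v′ a<k (inj₂ i≡c) = trans (cong (arrays s′ (10 + a)) (sym i≡c))
        (trans (written a a<k) (here′ u′ v′ i≡c))

  -- `view` is the memory as the product program sees it before relocation, a legitimate input for
  -- it.
  record Prepared (s : State) : Set where
    field
      size   : regs s 0 ≡ + n
      matrix : ∀ u v → arrays s 0 (cell u v) ≡ arcMatrix u v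
      view   : Holds {k} (λ _ → arcMatrix) (state (λ x → regs s (10 + x)) (λ a → arrays s (10 + a)))

  orient-run : ∀ s → Holds {1} (λ _ → adjacencyMatrix G) s → Runs W (orient k) s (M * (13 + k)) Prepared
  orient-run s holds = relax (ℕ.≤-reflexive (cong (λ c → M * suc (suc c)) (ℕ.+-comm (10 + k) 1)))
    (assign {v = + (n * n)} (trans (cong₂ ℤ._*_ H.size H.size) (apply-mul n n)) (small n*n≤M) ▸
    loop Oriented (λ _ _ → Oriented.counter) step (n * n) n*n≤M _ start ⨟ λ s′ inv → let open Oriented inv in
    single (assign {v = + n} (trans (ℤ.+-identityʳ _) size) n≤W) record
      { size = size
      ; matrix = λ u v → oriented u v z≤n
      ; view = record
        { size = refl
        ; other-regs = λ x → idle (suc x)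
        ; entries = λ j u v → copies (toℕ j) u v (Fin.toℕ<n j) z≤n
        ; padding = padding
        ; other-arrs = others
        }
      })
    where
    module H = Holds holds

    start : Oriented (n * n) (setReg 1 (+ (n * n)) s)
    start = record
      { size     = H.size
      ; counter  = refl
      ; bounded  = ℕ.≤-refl
      ; idle     = λ x → H.other-regs (9 + x)
      ; unread   = λ u v _ → H.entries zero u v
      ; oriented = λ u v n*n≤c → contradiction (cell<n*n u v) (ℕ.≤⇒≯ n*n≤c)
      ; copies   = λ a u v _ n*n≤c → contradiction (cell<n*n u v) (ℕ.≤⇒≯ n*n≤c)
      ; padding  = λ a j _ → H.other-arrs (10 + a) j (s≤s z≤n)
      ; others   = λ a j _ → H.other-arrs (10 + a) j (s≤s z≤n)
      }

    step : ∀ i s → Oriented (suc i) s → Runs W (orientBody k) s (9 + k) (Oriented i)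
    step i s inv with Fin.combine-surjective {n} {n} (fromℕ< (Oriented.bounded inv))
    ... | u , v , eq with trans (cong toℕ eq) (Fin.toℕ-fromℕ< (Oriented.bounded inv))
    ...   | refl = orient-step u v s inv

  -- Running the relocated product

  record Multiplied (s : State) : Set where
    field
      size    : regs s 0 ≡ + n
      matrix  : ∀ u v → arrays s 0 (cell u v) ≡ arcMatrix u v
      product : ∀ (f : Fin k → Fin n) → arrays s (10 + k) (toℕ (funToFin f)) ≡ + commonArcs f

  multiply-run : ∀ {P V T} → Solves (productProblem k 0) P V T → V n ≤ W →
    ∀ s → Prepared s → Runs W (shift P) s (T n) Multiplied
  multiply-run solves V≤W s prepared =
    let open Prepared prepared
        -- The parameter 0 limits entries to (2 + n) ^ 0 = 1, which bits satisfy.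
        s₁ , t , run , t≤T , output = solves n ((λ _ → arcMatrix) , λ _ u v → bit≤1 (arc u v)) _ view
        s₁′ , run′ , s₁∼ , unchanged = shift-run V≤W run (record { same-regs = λ _ → refl ; same-arrays = λ _ _ → refl })
    in s₁′ , t , run′ , t≤T , record
      { size    = trans (same-reg₀ unchanged) size
      ; matrix  = λ u v → trans (same-arr₀ unchanged _) (matrix u v)
      ; product = λ f → trans (sym (same-arrays s₁∼ k _)) (trans (output f) (dimProduct-arcs f))
      }

  index<n^ : ∀ {j} (f : Fin j → Fin n) → toℕ (funToFin f) < n ^ j
  index<n^ f = Fin.toℕ<n (funToFin f)

  index-injective : ∀ {j} {f g : Fin j → Fin n} → toℕ (funToFin f) ≡ toℕ (funToFin g) → f ≗ g
  index-injective {f = f} {g} eq i = trans (sym (Fin.finToFun-funToFin f i))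
    (trans (cong (λ t → finToFun t i) (Fin.toℕ-injective eq)) (Fin.finToFun-funToFin g i))

  index-surjective : ∀ {j i} → i < n ^ j → ∃ λ (f : Fin j → Fin n) → toℕ (funToFin f) ≡ i
  index-surjective {j} i<n^j = finToFun (fromℕ< i<n^j) ,
    trans (cong toℕ (Fin.funToFin-finToFin {j} {n} (fromℕ< i<n^j))) (Fin.toℕ-fromℕ< i<n^j)

  -- The tables of increasing cliques

  record Tabulated (j : ℕ) (s : State) : Set where
    field
      multiplied : Multiplied s
      power      : regs s 7 ≡ + (n ^ j)
      table      : ∀ (f : Fin (suc j) → Fin n) → arrays s 1 (toℕ (funToFin f)) ≡ + bit (chain f)
    open Multiplied multiplied public

  record Filling (i : ℕ) (s : State) : Set where
    field
      multiplied : Multiplied s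
      power      : regs s 7 ≡ 1ℤ
      counter    : regs s 1 ≡ + i
      bounded    : i ≤ n
      filled     : ∀ j → i ≤ j → j < n → arrays s 1 j ≡ 1ℤ
    open Multiplied multiplied public

  singletons-run : ∀ s → Multiplied s → Runs W singletons s (M * 6) (Tabulated 0)
  singletons-run s mult =
    assign {v = 1ℤ} refl 1≤W ▸
    assign {v = + n} (trans (ℤ.+-identityʳ _) (Multiplied.size mult)) n≤W ▸
    weaken finish (loop Filling (λ _ _ → Filling.counter) step n n≤M _ start)
    where
    start : Filling n (setReg 1 (+ n) (setReg 7 1ℤ s))
    start = record
      { multiplied = record { Multiplied mult }
      ; power      = refl
      ; counter    = refl
      ; bounded    = ℕ.≤-refl
      ; filled     = λ j n≤j j<n → contradiction j<n (ℕ.≤⇒≯ n≤j)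
      }

    step : ∀ i s → Filling (suc i) s → Runs W singletonsBody s 2 (Filling i)
    step i s inv =
      assign {v = + i} (cong (ℤ._- 1ℤ) counter) (ℕ.≤-trans (ℕ.<⇒≤ bounded) n≤W) ▹
      once (store {i = i} refl refl 1≤W) record
        { multiplied = record { Multiplied multiplied }
        ; power      = power
        ; counter    = refl
        ; bounded    = ℕ.<⇒≤ bounded
        ; filled     = λ j i≤j j<n → filled′ j (ℕ.m≤n⇒m<n∨m≡n i≤j) j<n
        }
      where
      open Filling inv
      filled′ : ∀ j → i < j ⊎ i ≡ j → j < n → arrays (setCell 1 i 1ℤ (setReg 1 (+ i) s)) 1 j ≡ 1ℤ
      filled′ j (inj₁ i<j) j<n = trans (read-other-index 1 1 1ℤ s (ℕ.<⇒≢ i<j)) (filled j i<j j<n)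
      filled′ j (inj₂ refl) j<n = read-same 1 j 1ℤ s

    finish : ∀ s → Filling 0 s → Tabulated 0 s
    finish s inv = record
      { multiplied = multiplied
      ; power      = power
      ; table      = λ f → filled _ z≤n (subst (toℕ (funToFin f) <_) (ℕ.*-identityʳ n) (index<n^ f))
      }
      where open Filling inv

  -- Both tables start at position 0 of array 1: cells below i still belong to the shorter tuples,
  -- cells from i on to the longer ones.
  record Extending (j i : ℕ) (s : State) : Set where
    field
      multiplied : Multiplied s
      power      : regs s 7 ≡ + (n ^ j)
      counter    : regs s 1 ≡ + i
      bounded    : i ≤ n ^ (2 + j)
      old        : ∀ (f : Fin (1 + j) → Fin n) → toℕ (funToFin f) < i →
                   arrays s 1 (toℕ (funToFin f)) ≡ + bit (chain f)
      new        : ∀ (f : Fin (2 + j) → Fin n) → i ≤ toℕ (funToFin f) →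
                   arrays s 1 (toℕ (funToFin f)) ≡ + bit (chain f)
    open Multiplied multiplied public

  -- The table is extended in place: the entries needed for position i lie at
  -- positions at most i, which a descending loop has not overwritten yet.
  extend-step : ∀ j → 2 + j ≤ k → (f : Fin (2 + j) → Fin n) → ∀ s →
    Extending j (suc (toℕ (funToFin f))) s → Runs W extendBody s 19 (Extending j (toℕ (funToFin f)))
  extend-step j 2+j≤k f s inv =
    assign {v = + i} (cong (ℤ._- 1ℤ) counter) i≤W ▹
    assign {v = + q} (trans (cong (apply div (+ i)) power) (apply-div q p R i≡ (Fin.toℕ<n ρ))) (cell≤W x y) ▹
    assign {v = + (q * p)} (trans (cong (λ z → + q ℤ.* z) power) (apply-mul q p))
      (ℕ.≤-trans (ℕ.m≤m+n (q * p) R) (ℕ.≤-trans (ℕ.≤-reflexive (sym i≡)) i≤W)) ▹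
    assign {v = + R} (apply-sub (q * p) R i≡) (ℕ.≤-trans (ℕ.m≤n+m R (Y * p)) yρ≤W′) ▹
    assign {v = + X} (trans (cong (apply div (+ q)) size) (apply-div X n Y q≡ (Fin.toℕ<n y)))
      (ℕ.≤-trans (ℕ.<⇒≤ (Fin.toℕ<n x)) n≤W) ▹
    assign {v = + (X * n)} (trans (cong (λ z → + X ℤ.* z) size) (apply-mul X n))
      (ℕ.≤-trans (ℕ.m≤m+n (X * n) Y) (ℕ.≤-trans (ℕ.≤-reflexive (sym q≡)) (cell≤W x y))) ▹
    assign {v = + Y} (apply-sub (X * n) Y q≡) (ℕ.≤-trans (ℕ.<⇒≤ (Fin.toℕ<n y)) n≤W) ▹
    assign {v = + (Y * p)} (trans (cong (λ z → + Y ℤ.* z) power) (apply-mul Y p))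
      (ℕ.≤-trans (ℕ.m≤m+n (Y * p) R) yρ≤W′) ▹
    assign {v = + toℕ (combine y ρ)} (cong +_ (sym (toℕ-combine′ y ρ))) (tuple≤W (f ∘ suc)) ▹
    -- The address equals i when x is vertex 0; the invariant at `suc i` still covers it.
    load refl (old (f ∘ suc) (s≤s yρ≤i)) (bit≤W (chain (f ∘ suc))) ▹
    assign {v = + (X * p)} (trans (cong (λ z → + X ℤ.* z) power) (apply-mul X p))
      (ℕ.≤-trans (ℕ.m≤m+n (X * p) R) (ℕ.≤-trans (ℕ.≤-reflexive (sym (toℕ-combine′ x ρ))) (tuple≤W f̂))) ▹
    assign {v = + toℕ (combine x ρ)} (cong +_ (sym (toℕ-combine′ x ρ))) (tuple≤W f̂) ▹
    load refl (old f̂ (s≤s xρ≤i)) (bit≤W (chain f̂)) ▹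
    assign {v = + bit (chain (f ∘ suc) ∧ chain f̂)} (mul-bit (chain (f ∘ suc)) (chain f̂))
      (bit≤W (chain (f ∘ suc) ∧ chain f̂)) ▹
    assign {v = + (Y * n)} (trans (cong (λ z → + Y ℤ.* z) size) (apply-mul Y n))
      (ℕ.≤-trans (ℕ.m≤m+n (Y * n) X) (ℕ.≤-trans (ℕ.≤-reflexive (sym (toℕ-combine′ y x))) (cell≤W y x))) ▹
    assign {v = + cell y x} (cong +_ (sym (toℕ-combine′ y x))) (cell≤W y x) ▹
    load refl (matrix y x) (bit≤W (arc y x)) ▹
    assign {v = + bit (chain f)}
      (trans (mul-bit (chain (f ∘ suc) ∧ chain f̂) (arc y x)) (cong (+_ ∘ bit) (sym (chain-step f))))
      (bit≤W (chain f)) ▹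
    once (store {i = i} refl refl (bit≤W (chain f))) record
      { multiplied = record { Multiplied multiplied }
      ; power      = power
      ; counter    = refl
      ; bounded    = ℕ.<⇒≤ bounded
      ; old        = λ g g<i → trans (read-other-index 1 1 _ s (ℕ.<⇒≢ g<i ∘ sym)) (old g (ℕ.m<n⇒m<1+n g<i))
      ; new        = λ g i≤g → new′ g (ℕ.m≤n⇒m<n∨m≡n i≤g)
      }
    where
    open Extending inv
    x = f zero
    y = f (suc zero)
    ρ = funToFin (λ l → f (suc (suc l)))
    f̂ = x Vector.∷ λ l → f (suc (suc l))
    i = toℕ (funToFin f)
    p = n ^ j
    q = cell x y
    X = toℕ x
    Y = toℕ y
    R = toℕ ρ

    q≡ : q ≡ X * n + Y
    q≡ = toℕ-combine′ x y

    -- `funToFin` nests the code to the right; the division needs the pair (x, y) in front.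
    i≡ : i ≡ q * p + R
    i≡ = begin
      i                              ≡⟨ toℕ-combine′ x (combine y ρ) ⟩
      X * (n * p) + toℕ (combine y ρ)  ≡⟨ cong₂ _+_ (sym (ℕ.*-assoc X n p)) (toℕ-combine′ y ρ) ⟩
      X * n * p + (Y * p + R)        ≡⟨ ℕ.+-assoc (X * n * p) (Y * p) R ⟨
      X * n * p + Y * p + R          ≡⟨ cong (_+ R) (ℕ.*-distribʳ-+ p (X * n) Y) ⟨
      (X * n + Y) * p + R            ≡⟨ cong (λ z → z * p + R) q≡ ⟨
      q * p + R                      ∎
      where open ≡-Reasoning

    i≤W : i ≤ W
    i≤W = small (ℕ.≤-trans (ℕ.<⇒≤ (index<n^ f)) (powers≤M (2 + j) 2+j≤k))

    tuple≤W : (g : Fin (1 + j) → Fin n) → toℕ (funToFin g) ≤ W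
    tuple≤W g = small (ℕ.≤-trans (ℕ.<⇒≤ (index<n^ g)) (powers≤M (1 + j) (ℕ.<⇒≤ 2+j≤k)))

    yρ≤W′ : Y * p + R ≤ W
    yρ≤W′ = subst (_≤ W) (toℕ-combine′ y ρ) (tuple≤W (f ∘ suc))

    yρ≤i : toℕ (combine y ρ) ≤ i
    yρ≤i = ℕ.≤-trans (ℕ.m≤n+m _ (X * (n * p))) (ℕ.≤-reflexive (sym (toℕ-combine′ x (combine y ρ))))

    X≤q : X ≤ q
    X≤q = ℕ.≤-trans (X≤X*n n (Fin.toℕ<n y)) (ℕ.≤-trans (ℕ.m≤m+n (X * n) Y) (ℕ.≤-reflexive (sym q≡)))
      where
      -- The bound needs n positive, and the vertex y provides this.
      X≤X*n : ∀ l → Y < l → X ≤ X * l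
      X≤X*n (suc l) _ = ℕ.m≤m*n X (suc l)

    xρ≤i : toℕ (combine x ρ) ≤ i
    xρ≤i = ℕ.≤-trans (ℕ.≤-reflexive (toℕ-combine′ x ρ))
      (ℕ.≤-trans (ℕ.+-monoˡ-≤ R (ℕ.*-monoˡ-≤ p X≤q)) (ℕ.≤-reflexive (sym i≡)))

    mul-bit : ∀ a b → apply mul (+ bit a) (+ bit b) ≡ + bit (a ∧ b)
    mul-bit a b = trans (apply-mul (bit a) (bit b)) (cong +_ (sym (bit-∧ a b)))

    new′ : (g : Fin (2 + j) → Fin n) → i < toℕ (funToFin g) ⊎ i ≡ toℕ (funToFin g) →
      arrays (setCell 1 i (+ bit (chain f)) s) 1 (toℕ (funToFin g)) ≡ + bit (chain g)
    new′ g (inj₁ i<g) = trans (read-other-index 1 1 _ s (ℕ.<⇒≢ i<g)) (new g i<g)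
    new′ g (inj₂ i≡g) = trans (cong (arrays (setCell 1 i (+ bit (chain f)) s) 1) (sym i≡g))
      (trans (read-same 1 i _ s) (cong (+_ ∘ bit) (chain-cong {f = f} {g} (index-injective {f = f} {g} i≡g))))

  extend-run : ∀ j → 2 + j ≤ k → ∀ s → Tabulated j s → Runs W extend s (M * 24) (Tabulated (suc j))
  extend-run j 2+j≤k s tab =
    assign {v = + (n * n)} (trans (cong₂ ℤ._*_ size size) (apply-mul n n)) (small n*n≤M) ▸
    assign {v = + (n ^ (2 + j))}
      (trans (cong (λ z → + (n * n) ℤ.* z) power) (trans (apply-mul (n * n) (n ^ j)) (cong +_ (ℕ.*-assoc n n (n ^ j)))))
      (small n^[2+j]≤M) ▸
    loop (Extending j) (λ _ _ → Extending.counter) step (n ^ (2 + j)) n^[2+j]≤M _ start ⨟ λ s′ inv →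
    single (assign {v = + (n ^ (1 + j))}
      (trans (cong₂ ℤ._*_ (Extending.size inv) (Extending.power inv)) (apply-mul n (n ^ j)))
      (small (powers≤M (1 + j) (ℕ.<⇒≤ 2+j≤k)))) record
      { multiplied = record { Multiplied (Extending.multiplied inv) }
      ; power      = refl
      ; table      = λ f → Extending.new inv f z≤n
      }
    where
    open Tabulated tab
    n^[2+j]≤M = powers≤M (2 + j) 2+j≤k

    start : Extending j (n ^ (2 + j)) (setReg 1 (+ (n ^ (2 + j))) (setReg 1 (+ (n * n)) s))
    start = record
      { multiplied = record { Multiplied multiplied }
      ; power      = power
      ; counter    = refl
      ; bounded    = ℕ.≤-refl
      ; old        = λ f _ → table f
      ; new        = λ f n^≤f → contradiction (index<n^ f) (ℕ.≤⇒≯ n^≤f)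
      }

    step : ∀ i s → Extending j (suc i) s → Runs W extendBody s 19 (Extending j i)
    step i s inv with index-surjective {2 + j} (Extending.bounded inv)
    ... | f , refl = extend-step j 2+j≤k f s inv

  tabulate-run : ∀ j → 1 + j ≤ k → ∀ s → Multiplied s →
    Runs W (tabulateChains j) s (M * tabulateCost j) (Tabulated j)
  tabulate-run zero    _     s mult = singletons-run s mult
  tabulate-run (suc j) 2+j≤k s mult = tabulate-run j (ℕ.<⇒≤ 2+j≤k) s mult ⨟ extend-run j 2+j≤k

  -- Summing the product over the table

  record Summing (A : ℕ → ℕ → ℤ) (c : ℕ → ℕ) (i : ℕ) (s : State) : Set where
    field
      kept-arrays : arrays s ≡ A
      counter     : regs s 1 ≡ + i
      bounded     : i ≤ n ^ k
      partial     : ℕ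
      accumulator : regs s 8 ≡ + partial
      remaining   : partial + ∑ {i} (c ∘ toℕ) ≡ cliqueCount

  commonArcs≤n : ∀ f → commonArcs f ≤ n
  commonArcs≤n f = subst (commonArcs f ≤_) (ℕ.*-identityʳ n)
    (∑-bound {n} _ λ ℓ → bit≤1 (⋀ λ j → arc (f j) ℓ))

  cliqueCount≤W : cliqueCount ≤ W
  cliqueCount≤W = begin
    cliqueCount  ≤⟨ ∑-bound {n ^ k} {n} _ (λ t → ℕ.≤-trans
                      (ℕ.*-mono-≤ (bit≤1 (chain (digits t))) (commonArcs≤n (digits t)))
                      (ℕ.≤-reflexive (ℕ.*-identityˡ n))) ⟩
    n ^ k * n    ≤⟨ ℕ.*-monoˡ-≤ n (powers≤M k ℕ.≤-refl) ⟩
    M * n        ≡⟨ ℕ.*-comm M n ⟩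
    n * M        ≤⟨ n*M≤W ⟩
    W            ∎
    where open ℕ.≤-Reasoning

  total-run : ∀ s → Tabulated (suc m) s → Runs W (total k) s (M * 10) (λ s′ → regs s′ 0 ≡ + cliqueCount)
  total-run s tab =
    assign {v = 0ℤ} refl z≤n ▸
    assign {v = + (n ^ k)} (trans (cong₂ ℤ._*_ size power) (apply-mul n (n ^ suc m))) (small n^k≤M) ▸
    loop (Summing A c) (λ _ _ → Summing.counter) step (n ^ k) n^k≤M _ start ⨟ λ s′ inv →
    single (assign {v = + cliqueCount}
      (trans (ℤ.+-identityʳ _) (trans (Summing.accumulator inv)
        (cong +_ (trans (sym (ℕ.+-identityʳ _)) (Summing.remaining inv)))))
      cliqueCount≤W) refl
    where
    open Tabulated tab
    n^k≤M = powers≤M k ℕ.≤-refl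
    A = arrays s

    -- The absolute value turns the integer cell contents into a summand for every natural position;
    -- at codes of tuples the product is nonnegative by `summand`.
    c : ℕ → ℕ
    c i = ∣ A 1 i ℤ.* A (10 + k) i ∣

    summand : (f : Fin k → Fin n) → c (toℕ (funToFin f)) ≡ bit (chain f) * commonArcs f
    summand f = trans (cong₂ (λ a b → ∣ a ℤ.* b ∣) (table f) (product f))
      (cong ∣_∣ (apply-mul (bit (chain f)) (commonArcs f)))

    start : Summing A c (n ^ k) (setReg 1 (+ (n ^ k)) (setReg 8 0ℤ s))
    start = record
      { kept-arrays = refl
      ; counter     = refl
      ; bounded     = ℕ.≤-refl
      ; partial     = 0
      ; accumulator = refl
      ; remaining   = ∑-cong {n ^ k} λ t → trans
          (cong (c ∘ toℕ) (sym (Fin.funToFin-finToFin {k} {n} t))) (summand (digits t))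
      }

    step-at : (f : Fin k → Fin n) → ∀ s → Summing A c (suc (toℕ (funToFin f))) s →
      Runs W (totalBody k) s 5 (Summing A c (toℕ (funToFin f)))
    step-at f s inv =
      assign {v = + i} (cong (ℤ._- 1ℤ) counter) (small (ℕ.≤-trans (ℕ.<⇒≤ (index<n^ f)) n^k≤M)) ▹
      load refl (trans (cong (λ B → B 1 i) kept-arrays) (table f)) (bit≤W (chain f)) ▹
      load refl (trans (cong (λ B → B (10 + k) i) kept-arrays) (product f))
        (ℕ.≤-trans (commonArcs≤n f) n≤W) ▹
      assign {v = + c i} (trans (apply-mul (bit (chain f)) (commonArcs f)) (cong +_ (sym (summand f))))
        (ℕ.≤-trans (ℕ.m≤n+m (c i) partial) partial≤W) ▹
      once (assign {v = + (partial + c i)} (cong (ℤ._+ + c i) accumulator) partial≤W) record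
        { kept-arrays = kept-arrays
        ; counter     = refl
        ; bounded     = ℕ.<⇒≤ bounded
        ; partial     = partial + c i
        ; accumulator = refl
        ; remaining   = remaining′
        }
      where
      open Summing inv
      i = toℕ (funToFin f)

      remaining′ : partial + c i + ∑ {i} (c ∘ toℕ) ≡ cliqueCount
      remaining′ = begin
        partial + c i + ∑ {i} (c ∘ toℕ)    ≡⟨ ℕ.+-assoc partial (c i) _ ⟩
        partial + (c i + ∑ {i} (c ∘ toℕ))  ≡⟨ cong (λ z → partial + z) (ℕ.+-comm (c i) _) ⟩
        partial + (∑ {i} (c ∘ toℕ) + c i)  ≡⟨ cong (λ z → partial + z) (∑-snoc i c) ⟨
        partial + ∑ {suc i} (c ∘ toℕ)      ≡⟨ remaining ⟩
        cliqueCount                        ∎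
        where open ≡-Reasoning

      -- Summands are naturals, so no partial sum exceeds the final count.
      partial≤W : partial + c i ≤ W
      partial≤W = ℕ.≤-trans (ℕ.m≤m+n _ _) (ℕ.≤-trans (ℕ.≤-reflexive remaining′) cliqueCount≤W)

    step : ∀ i s → Summing A c (suc i) s → Runs W (totalBody k) s 5 (Summing A c i)
    step i s inv with index-surjective {k} (Summing.bounded inv)
    ... | f , refl = step-at f s inv

  countCliques-run : ∀ {P V T} → Solves (productProblem k 0) P V T → V n ≤ W →
    ∀ s → Holds {1} (λ _ → adjacencyMatrix G) s →
    Runs W (countCliques m P) s (M * (13 + k) + (T n + M * (tabulateCost (suc m) + 10)))
      (λ s′ → regs s′ 0 ≡ + cliqueCount)
  countCliques-run solves V≤W s holds =
    orient-run s holds ⟫ λ s₁ prepared →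
    multiply-run solves V≤W s₁ prepared ⟫ λ s₂ mult →
    tabulate-run (suc m) ℕ.≤-refl s₂ mult ⨟ total-run

-- Running times

≤·^ℚ-mono : ∀ {x y C D} n q → x ≤ y → C ≤ D → y ≤ C · n ^ℚ q → x ≤ D · n ^ℚ q
≤·^ℚ-mono n q x≤y C≤D with ↥ q
... | + a = λ y≤ → ℕ.≤-trans (ℕ.^-monoˡ-≤ (↧ₙ q) x≤y)
  (ℕ.≤-trans y≤ (ℕ.*-monoˡ-≤ (n ^ a) (ℕ.^-monoˡ-≤ (↧ₙ q) C≤D)))
... | -[1+ a ] = λ y≤ → ℕ.≤-trans (ℕ.*-monoˡ-≤ (n ^ suc a) (ℕ.^-monoˡ-≤ (↧ₙ q) x≤y))
  (ℕ.≤-trans y≤ (ℕ.^-monoˡ-≤ (↧ₙ q) C≤D))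

^-distribʳ-* : ∀ a x y → (x * y) ^ a ≡ x ^ a * y ^ a
^-distribʳ-* zero    x y = refl
^-distribʳ-* (suc a) x y = trans (cong (x * y *_) (^-distribʳ-* a x y))
  (ℕ.[m*n]*[o*p]≡[m*o]*[n*p] x y (x ^ a) (y ^ a))

-- For n at least 1, (n + 1) ^ a is at most 2 ^ a * n ^ a, whence the threshold `suc n₀`. One
-- constant must serve both terms, so 2 ^ a * c is added to `C`; truncated subtraction then leaves
-- at most `T n`.
O-add-power : ∀ α β {T} a c → (∀ q → β <ℚ q → α <ℚ q) → O[n^ α ] T →
  O[n^ a +n^ β ] (λ n → T n + suc n ^ a * c)
O-add-power α β {T} a c α≤β (C , n₀ , T≤) = C′ , suc n₀ , λ n n₀<n q β<q →
  ≤·^ℚ-mono n q (rest≤T n n₀<n) (ℕ.m≤m+n C (2 ^ a * c)) (T≤ n (ℕ.<⇒≤ n₀<n) q (α≤β q β<q))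
  where
  C′ = C + 2 ^ a * c

  rest≤T : ∀ n → n₀ < n → T n + suc n ^ a * c ∸ C′ * n ^ a ≤ T n
  rest≤T n n₀<n = ℕ.m≤n+o⇒m∸n≤o _ _ (ℕ.≤-trans (ℕ.+-monoʳ-≤ (T n) power≤) (ℕ.≤-reflexive (ℕ.+-comm (T n) _)))
    where
    open ℕ.≤-Reasoning
    power≤ : suc n ^ a * c ≤ C′ * n ^ a
    power≤ = begin
      suc n ^ a * c          ≤⟨ ℕ.*-monoˡ-≤ c (ℕ.^-monoˡ-≤ a (ℕ.+-mono-≤ (ℕ.≤-trans (s≤s z≤n) n₀<n) (ℕ.m≤m+n n 0))) ⟩
      (2 * n) ^ a * c        ≡⟨ cong (_* c) (^-distribʳ-* a 2 n) ⟩
      2 ^ a * n ^ a * c      ≡⟨ ℕ.*-assoc (2 ^ a) (n ^ a) c ⟩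
      2 ^ a * (n ^ a * c)    ≡⟨ cong (2 ^ a *_) (ℕ.*-comm (n ^ a) c) ⟩
      2 ^ a * (c * n ^ a)    ≡⟨ ℕ.*-assoc (2 ^ a) c (n ^ a) ⟨
      2 ^ a * c * n ^ a      ≤⟨ ℕ.*-monoˡ-≤ (n ^ a) (ℕ.m≤n+m (2 ^ a * c) C) ⟩
      C′ * n ^ a             ∎

-- α is the exponent of the given product algorithm, β the claimed one. Both equal ω if ω is
-- attained; otherwise they are rationals p < q.
cliques-from-product : ∀ α β m → (∀ q → β <ℚ q → α <ℚ q) →
  productProblem (2 + m) 0 SolvableInTime O[n^ α ] →
  copyCounting (K (3 + m)) SolvableInTime O[n^ 2 + m +n^ β ]
cliques-from-product α β m α≤β (P , d , T , solves , T≤) =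
  -- The product needs words of exponent `d`; the further `3 + m` makes room for n * M.
  countCliques m P , d + (3 + m) , (λ n → T n + suc n ^ (2 + m) * c) , correct , O-add-power α β (2 + m) c α≤β T≤
  where
  c = (15 + m) + (tabulateCost (suc m) + 10)

  correct : Solves (copyCounting (K (3 + m))) (countCliques m P) (λ n → (2 + n) ^ (d + (3 + m)))
    (λ n → T n + suc n ^ (2 + m) * c)
  correct n G s holds =
    let s′ , t , run , t≤ , count = Run.countCliques-run solves V≤W s holds
    in s′ , t , run , ℕ.≤-trans t≤ (ℕ.≤-reflexive (collect M (15 + m) (tabulateCost (suc m) + 10) (T n))) ,
       _ , Counting.cliqueCount-correct G (2 + m) , count
    where
    M = suc n ^ (2 + m)
    W = (2 + n) ^ (d + (3 + m))

    V≤W : (2 + n) ^ d ≤ W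
    V≤W = ℕ.^-monoʳ-≤ (2 + n) (ℕ.m≤m+n d (3 + m))

    M*[2+n]≤W : (2 + n) * M ≤ W
    M*[2+n]≤W = ℕ.≤-trans (ℕ.*-monoʳ-≤ (2 + n) (ℕ.^-monoˡ-≤ (2 + m) (ℕ.n≤1+n (suc n))))
      (ℕ.^-monoʳ-≤ (2 + n) (ℕ.m≤n+m (3 + m) d))

    1≤M : 1 ≤ M
    1≤M = ℕ.^-monoʳ-≤ (suc n) {0} {2 + m} z≤n

    powers≤M : ∀ j → j ≤ 2 + m → n ^ j ≤ M
    powers≤M j j≤k = ℕ.≤-trans (ℕ.^-monoˡ-≤ j (ℕ.n≤1+n n)) (ℕ.^-monoʳ-≤ (suc n) j≤k)

    module Run = Correctness G m W M 1≤M powers≤M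
      (ℕ.≤-trans (ℕ.m≤m+n M _) M*[2+n]≤W)
      (ℕ.≤-trans (ℕ.*-monoˡ-≤ M (ℕ.m≤n+m n 2)) M*[2+n]≤W)

    collect : ∀ M a b t → M * a + (t + M * b) ≡ t + M * (a + b)
    collect M a b t = begin
      M * a + (t + M * b)  ≡⟨ ℕ.+-assoc (M * a) t (M * b) ⟨
      M * a + t + M * b    ≡⟨ cong (_+ M * b) (ℕ.+-comm (M * a) t) ⟩
      t + M * a + M * b    ≡⟨ ℕ.+-assoc t (M * a) (M * b) ⟩
      t + (M * a + M * b)  ≡⟨ cong (λ z → t + z) (ℕ.*-distribˡ-+ M a b) ⟨
      t + M * (a + b)      ∎
      where open ≡-Reasoning

theorem1 : (r : ℕ) → 3 ≤ r →
    (ProductInTime (r ∸ 1) (ω (r ∸ 1)) →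
    copyCounting (K r) SolvableInTime O[n^ (r ∸ 1) +n^ ω (r ∸ 1) ])
    × ((q : ℚ) → ω (r ∸ 1) <ℚ q →
    copyCounting (K r) SolvableInTime O[n^ (r ∸ 1) +n^ rational q ])
theorem1 (suc (suc (suc m))) (s≤s (s≤s (s≤s z≤n))) =
  (λ product → cliques-from-product (ω k) (ω k) m (λ _ ω<q → ω<q) (product 0)) ,
  -- A rational above the infimum comes with a smaller exponent p that some algorithm achieves.
  λ q (p , product , p<q) →
    cliques-from-product (rational p) (rational q) m (λ _ → ℚ.<-trans p<q) (product 0)
  where
  k = 2 + m
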